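{- Let $\operatorname{Pic}(\operatorname{Spec}\mathbf{Z})$ be the commutative monoid of isomorphism classes of torsion-free rank-1 abelian groups with product induced by $\otimes_{\mathbf{Z}}$ (equivalently, arithmetic divisors $\sum_p n_p[p]$, $n_p\in\mathbf{Z}\cup\{+\infty\}$, $n_p<0$ for finitely many $p$, modulo principal divisors, with addition). Let $\mathcal{P}$ be the set of all subsets $S$ of the set of rational primes, and define $\Theta:\mathcal{P}\to\operatorname{Pic}(\operatorname{Spec}\mathbf{Z})$ by $\Theta(S)=[\mathbf{Z}[1/p\mid p\in S]]$. Then the image of $\Theta$ is exactly the set of idempotent elements of $\operatorname{Pic}(\operatorname{Spec}\mathbf{Z})$. -}

module Defs where

open import Algebra.Bundles using (AbelianGroup; CommutativeMonoid; RawGroup)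
import Algebra.Definitions.RawMonoid as RawMonoidDefinitions
import Algebra.Morphism.Construct.Composition as Composition
import Algebra.Morphism.Construct.Identity as Identity
import Algebra.Morphism.GroupMonomorphism as GroupMonomorphism
open import Algebra.Morphism.Structures
  using (IsGroupHomomorphism; IsGroupIsomorphism; IsGroupMonomorphism)
import Algebra.Properties.AbelianGroup as AbelianGroupProperties
import Algebra.Properties.CommutativeMonoid.Mult as CommutativeMult
import Algebra.Properties.CommutativeSemigroup as CommutativeSemigroupProperties
import Algebra.Properties.Group as GroupProperties
import Algebra.Properties.Monoid.Mult as Mult
open import Data.Empty using (⊥; ⊥-elim)
open import Data.Fin.Base using (zero; suc)
open import Data.Integer.Base as ℤ using (ℤ; +_; -[1+_]; 0ℤ; 1ℤ)
import Data.Integer.Divisibility.Signed as ℤ∣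
import Data.Integer.Properties as ℤ
open import Data.Integer.Tactic.RingSolver using (solve-∀)
open import Data.Nat.Base as ℕ using (ℕ; zero; suc)
import Data.Nat.GCD as ℕ
import Data.Nat.Properties as ℕ
open import Data.Nat.Primality using (Prime)
open import Data.Product.Base using (Σ; ∃; _×_; _,_; proj₁; proj₂)
open import Data.Rational.Base as ℚ using (ℚ; 0ℚ; 1ℚ; toℚᵘ)
import Data.Rational.Properties as ℚ
open import Data.Rational.Unnormalised.Base as ℚᵘ using (ℚᵘ; mkℚᵘ; 0ℚᵘ; _≃_; *≡*)
import Data.Rational.Unnormalised.Properties as ℚᵘ
open import Data.Sum.Base using (_⊎_; inj₁; inj₂; [_,_]′)
open import Data.Vec.Functional using (Vector; _∷_)
open import Level using (0ℓ) renaming (suc to lsuc)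
open import Relation.Binary.Core using (Rel)
open import Relation.Binary.Definitions using (Reflexive; Symmetric; Transitive)
open import Relation.Binary.PropositionalEquality
  using (_≡_; _≢_; refl; sym; trans; cong; cong₂; module ≡-Reasoning)
import Relation.Binary.Reasoning.Setoid as SetoidReasoning
open import Relation.Nullary.Decidable.Core using (yes; no)
open import Relation.Unary using (Pred; _∈_; _⊆_)

module Additive (A : AbelianGroup 0ℓ 0ℓ) where
  open AbelianGroup A public
    using (Carrier; _≈_; setoid; rawMonoid; rawGroup; group; monoid;
           commutativeMonoid; commutativeSemigroup)
    renaming
      ( _∙_ to _+_ ; ε to 0# ; _⁻¹ to -_
      ; refl to ≈-refl ; sym to ≈-sym ; trans to ≈-trans ; reflexive to ≈-reflexive
      ; ∙-cong to +-cong ; ∙-congˡ to +-congˡ ; ∙-congʳ to +-congʳ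
      ; ⁻¹-cong to -‿cong
      ; assoc to +-assoc ; comm to +-comm
      ; identityˡ to +-identityˡ ; identityʳ to +-identityʳ
      ; inverseˡ to -‿inverseˡ ; inverseʳ to -‿inverseʳ )

  open RawMonoidDefinitions rawMonoid public using (sum) renaming (_×_ to _×ₙ_)

  infixr 8 _·_

  _·_ : ℤ → Carrier → Carrier
  (+ n)    · a = n ×ₙ a
  -[1+ n ] · a = - (suc n ×ₙ a)

  linearCombination : ∀ {r} → Vector ℤ r → Vector Carrier r → Carrier
  linearCombination c v = sum (λ i → c i · v i)

  LinearlyIndependent : ∀ {r} → Vector Carrier r → Set
  LinearlyIndependent v = ∀ c → linearCombination c v ≈ 0# → ∀ i → c i ≡ 0ℤ

  LinearlyDependent : ∀ {r} → Vector Carrier r → Set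
  LinearlyDependent v = ∃ λ c → (∃ λ i → c i ≢ 0ℤ) × linearCombination c v ≈ 0#

  TorsionFree : Set
  TorsionFree = ∀ k a → k ≢ 0ℤ → k · a ≈ 0# → a ≈ 0#

  -- r is the size of a maximal ℤ-linearly independent family; maximality is
  -- stated positively, as linear dependence of every one-element extension.
  HasRank : ℕ → Set
  HasRank r = ∃ λ (v : Vector Carrier r) →
    LinearlyIndependent v × (∀ a → LinearlyDependent (a ∷ v))

module MultipleProperties (A : AbelianGroup 0ℓ 0ℓ) where
  open Additive A
  open GroupProperties group
    using (⁻¹-involutive; inverseˡ-unique; ε⁻¹≈ε; x∙y⁻¹≈ε⇒x≈y; x≈y⇒x∙y⁻¹≈ε)
  open AbelianGroupProperties A using (⁻¹-∙-comm)
  open Mult monoid using (×-congʳ; ×-homo-+)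
  open CommutativeMult commutativeMonoid using (×-distrib-+)
  open CommutativeSemigroupProperties commutativeSemigroup using (interchange)
  open SetoidReasoning setoid

  ·-congˡ : ∀ k {a b} → a ≈ b → k · a ≈ k · b
  ·-congˡ (+ n)    e = ×-congʳ n e
  ·-congˡ -[1+ n ] e = -‿cong (×-congʳ (suc n) e)

  ·-congʳ : ∀ {k l} a → k ≡ l → k · a ≈ l · a
  ·-congʳ a refl = ≈-refl

  -0#≈0# : - 0# ≈ 0#
  -0#≈0# = ε⁻¹≈ε

  ×ₙ-zeroʳ : ∀ n → n ×ₙ 0# ≈ 0#
  ×ₙ-zeroʳ zero    = ≈-refl
  ×ₙ-zeroʳ (suc n) = ≈-trans (+-identityˡ _) (×ₙ-zeroʳ n)

  ·-zeroʳ : ∀ k → k · 0# ≈ 0#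
  ·-zeroʳ (+ n)    = ×ₙ-zeroʳ n
  ·-zeroʳ -[1+ n ] = ≈-trans (-‿cong (×ₙ-zeroʳ (suc n))) -0#≈0#

  ·-identity : ∀ a → 1ℤ · a ≈ a
  ·-identity = +-identityʳ

  ·-distribˡ : ∀ k a b → k · (a + b) ≈ k · a + k · b
  ·-distribˡ (+ n)    a b = ×-distrib-+ a b n
  ·-distribˡ -[1+ n ] a b =
    ≈-trans (-‿cong (×-distrib-+ a b (suc n))) (≈-sym (⁻¹-∙-comm _ _))

  ⊖-· : ∀ m n a → (m ℤ.⊖ n) · a ≈ m ×ₙ a + - (n ×ₙ a)
  ⊖-· m zero a = ≈-sym (≈-trans (+-congˡ -0#≈0#) (+-identityʳ _))
  ⊖-· zero (suc n) a = ≈-sym (+-identityˡ _)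
  ⊖-· (suc m) (suc n) a = begin
    (suc m ℤ.⊖ suc n) · a                 ≈⟨ ·-congʳ a (ℤ.[1+m]⊖[1+n]≡m⊖n m n) ⟩
    (m ℤ.⊖ n) · a                         ≈⟨ ⊖-· m n a ⟩
    m ×ₙ a + - (n ×ₙ a)                   ≈⟨ +-identityˡ _ ⟨
    0# + (m ×ₙ a + - (n ×ₙ a))            ≈⟨ +-congʳ (-‿inverseʳ a) ⟨
    (a + - a) + (m ×ₙ a + - (n ×ₙ a))     ≈⟨ interchange _ _ _ _ ⟩
    (a + m ×ₙ a) + (- a + - (n ×ₙ a))     ≈⟨ +-congˡ (⁻¹-∙-comm _ _) ⟩
    (a + m ×ₙ a) + - (a + n ×ₙ a)         ∎

  ·-distribʳ : ∀ k l a → (k ℤ.+ l) · a ≈ k · a + l · a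
  ·-distribʳ (+ m)    (+ n)    a = ×-homo-+ a m n
  ·-distribʳ (+ m)    -[1+ n ] a = ⊖-· m (suc n) a
  ·-distribʳ -[1+ m ] (+ n)    a = ≈-trans (⊖-· n (suc m) a) (+-comm _ _)
  ·-distribʳ -[1+ m ] -[1+ n ] a = begin
    - (suc (suc (m ℕ.+ n)) ×ₙ a)        ≡⟨ cong (λ t → - (suc t ×ₙ a)) (ℕ.+-suc m n) ⟨
    - ((suc m ℕ.+ suc n) ×ₙ a)          ≈⟨ -‿cong (×-homo-+ a (suc m) (suc n)) ⟩
    - (suc m ×ₙ a + suc n ×ₙ a)         ≈⟨ ⁻¹-∙-comm _ _ ⟨
    - (suc m ×ₙ a) + - (suc n ×ₙ a)     ∎

  -‿· : ∀ k a → (ℤ.- k) · a ≈ - (k · a)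
  -‿· k a = inverseˡ-unique _ _ (begin
    (ℤ.- k) · a + k · a  ≈⟨ ·-distribʳ (ℤ.- k) k a ⟨
    (ℤ.- k ℤ.+ k) · a    ≈⟨ ·-congʳ a (ℤ.+-inverseˡ k) ⟩
    0#                   ∎)

  ·-neg : ∀ k a → k · (- a) ≈ - (k · a)
  ·-neg k a = inverseˡ-unique _ _ (begin
    k · (- a) + k · a  ≈⟨ ·-distribˡ k (- a) a ⟨
    k · (- a + a)      ≈⟨ ·-congˡ k (-‿inverseˡ a) ⟩
    k · 0#             ≈⟨ ·-zeroʳ k ⟩
    0#                 ∎)

  ×ₙ-assoc : ∀ n l a → (+ n ℤ.* l) · a ≈ n ×ₙ (l · a)
  ×ₙ-assoc zero    l a = ·-congʳ a (ℤ.*-zeroˡ l)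
  ×ₙ-assoc (suc n) l a = begin
    (+ suc n ℤ.* l) · a          ≈⟨ ·-congʳ a (ℤ.suc-* (+ n) l) ⟩
    (l ℤ.+ + n ℤ.* l) · a        ≈⟨ ·-distribʳ l (+ n ℤ.* l) a ⟩
    l · a + (+ n ℤ.* l) · a      ≈⟨ +-congˡ (×ₙ-assoc n l a) ⟩
    l · a + n ×ₙ (l · a)         ∎

  ·-assoc : ∀ k l a → (k ℤ.* l) · a ≈ k · (l · a)
  ·-assoc (+ n)    l a = ×ₙ-assoc n l a
  ·-assoc -[1+ n ] l a = begin
    (-[1+ n ] ℤ.* l) · a           ≈⟨ ·-congʳ a (ℤ.neg-distribˡ-* (+ suc n) l) ⟨
    (ℤ.- (+ suc n ℤ.* l)) · a      ≈⟨ -‿· (+ suc n ℤ.* l) a ⟩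
    - ((+ suc n ℤ.* l) · a)        ≈⟨ -‿cong (×ₙ-assoc (suc n) l a) ⟩
    - (suc n ×ₙ (l · a))           ∎

  ·-swap : ∀ k l a → k · (l · a) ≈ l · (k · a)
  ·-swap k l a = begin
    k · (l · a)   ≈⟨ ·-assoc k l a ⟨
    (k ℤ.* l) · a ≈⟨ ·-congʳ a (ℤ.*-comm k l) ⟩
    (l ℤ.* k) · a ≈⟨ ·-assoc l k a ⟩
    l · (k · a)   ∎

  ·-cancel : TorsionFree → ∀ k {a b} → k ≢ 0ℤ → k · a ≈ k · b → a ≈ b
  ·-cancel tf k {a} {b} k≢0 e = x∙y⁻¹≈ε⇒x≈y a b (tf k _ k≢0 (begin
    k · (a + - b)        ≈⟨ ·-distribˡ k a (- b) ⟩
    k · a + k · (- b)    ≈⟨ +-congˡ (·-neg k b) ⟩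
    k · a + - (k · b)    ≈⟨ x≈y⇒x∙y⁻¹≈ε e ⟩
    0#                   ∎))

infix 4 _≅_

_≅_ : AbelianGroup 0ℓ 0ℓ → AbelianGroup 0ℓ 0ℓ → Set
A ≅ B = ∃ λ (f : A.Carrier → B.Carrier) → IsGroupIsomorphism A.rawGroup B.rawGroup f
  where
  module A = AbelianGroup A
  module B = AbelianGroup B

module _ {A B : AbelianGroup 0ℓ 0ℓ} where
  private
    module A = Additive A
    module B = Additive B

  module _ {f : A.Carrier → B.Carrier}
           (f-cong : ∀ {x y} → x A.≈ y → f x B.≈ f y)
           (f-+ : ∀ x y → f (x A.+ y) B.≈ f x B.+ f y) where

    open GroupProperties B.group using (identityʳ-unique; inverseˡ-unique)

    additive-0 : f A.0# B.≈ B.0#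
    additive-0 = identityʳ-unique (f A.0#) (f A.0#)
      (B.≈-trans (B.≈-sym (f-+ A.0# A.0#)) (f-cong (A.+-identityˡ A.0#)))

    additive-neg : ∀ x → f (A.- x) B.≈ B.- f x
    additive-neg x = inverseˡ-unique _ _
      (B.≈-trans (B.≈-sym (f-+ (A.- x) x))
        (B.≈-trans (f-cong (A.-‿inverseˡ x)) additive-0))

    additive-×ₙ : ∀ n x → f (n A.×ₙ x) B.≈ n B.×ₙ f x
    additive-×ₙ zero    x = additive-0
    additive-×ₙ (suc n) x = B.≈-trans (f-+ _ _) (B.+-congˡ (additive-×ₙ n x))

    additive-· : ∀ k x → f (k A.· x) B.≈ k B.· f x
    additive-· (+ n)    x = additive-×ₙ n x
    additive-· -[1+ n ] x =
      B.≈-trans (additive-neg _) (B.-‿cong (additive-×ₙ (suc n) x))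

    additive⇒isGroupHomomorphism : IsGroupHomomorphism A.rawGroup B.rawGroup f
    additive⇒isGroupHomomorphism = record
      { isMonoidHomomorphism = record
        { isMagmaHomomorphism = record
          { isRelHomomorphism = record { cong = f-cong }
          ; homo = f-+
          }
        ; ε-homo = additive-0
        }
      ; ⁻¹-homo = additive-neg
      }

    mk≅ : (g : B.Carrier → A.Carrier) →
          (∀ {x y} → x B.≈ y → g x A.≈ g y) →
          (∀ y → f (g y) B.≈ y) → (∀ x → g (f x) A.≈ x) → A ≅ B
    mk≅ g g-cong fg gf = f , record
      { isGroupMonomorphism = record
        { isGroupHomomorphism = additive⇒isGroupHomomorphism
        ; injective = λ {x} {y} e →
            A.≈-trans (A.≈-sym (gf x)) (A.≈-trans (g-cong e) (gf y))
        }
      ; surjective = λ y → g y , λ e → B.≈-trans (f-cong e) (fg y)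
      }

≅-refl : Reflexive _≅_
≅-refl {A} = _ , Identity.isGroupIsomorphism A.rawGroup A.refl
  where module A = AbelianGroup A

≅-trans : Transitive _≅_
≅-trans {A} {B} {C} (f , f-iso) (g , g-iso) =
  _ , Composition.isGroupIsomorphism (AbelianGroup.trans C) f-iso g-iso

record Inverses (A B : AbelianGroup 0ℓ 0ℓ) : Set where
  private
    module A = Additive A
    module B = Additive B
  field
    to        : A.Carrier → B.Carrier
    from      : B.Carrier → A.Carrier
    to-cong   : ∀ {x y} → x A.≈ y → to x B.≈ to y
    from-cong : ∀ {x y} → x B.≈ y → from x A.≈ from y
    to-+      : ∀ x y → to (x A.+ y) B.≈ to x B.+ to y
    from-+    : ∀ x y → from (x B.+ y) A.≈ from x A.+ from y
    to-from   : ∀ y → to (from y) B.≈ y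
    from-to   : ∀ x → from (to x) A.≈ x

module _ {A B : AbelianGroup 0ℓ 0ℓ} where
  private
    module A = Additive A
    module B = Additive B

  ≅⇒Inverses : A ≅ B → Inverses A B
  ≅⇒Inverses (f , f-iso) = record
    { to = f ; from = g
    ; to-cong = ⟦⟧-cong
    ; from-cong = λ {x} {y} e →
        injective (B.≈-trans (fg x) (B.≈-trans e (B.≈-sym (fg y))))
    ; to-+ = ∙-homo
    ; from-+ = λ x y → injective (B.≈-trans (fg _)
        (B.≈-sym (B.≈-trans (∙-homo _ _) (B.+-cong (fg x) (fg y)))))
    ; to-from = fg
    ; from-to = λ x → injective (fg (f x))
    }
    where
    open IsGroupIsomorphism f-iso using (⟦⟧-cong; ∙-homo; injective; surjective)

    g : B.Carrier → A.Carrier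
    g y = proj₁ (surjective y)

    fg : ∀ y → f (g y) B.≈ y
    fg y = proj₂ (surjective y) A.≈-refl

  Inverses⇒≅ : Inverses A B → A ≅ B
  Inverses⇒≅ i = mk≅ {A} {B} {to} to-cong to-+ from from-cong to-from from-to
    where open Inverses i

≅-sym : Symmetric _≅_
≅-sym {A} {B} e = mk≅ {B} {A} {from} from-cong from-+ to to-cong from-to to-from
  where open Inverses (≅⇒Inverses {A} {B} e)

module TensorProduct (A B : AbelianGroup 0ℓ 0ℓ) where
  private
    module A = Additive A
    module B = Additive B

  infixl 7 _⊗_
  infixl 6 _+ᵗ_
  infix 8 -ᵗ_
  infix 4 _≈ᵗ_

  data Tensor : Set where
    _⊗_  : A.Carrier → B.Carrier → Tensor
    0ᵗ   : Tensor
    _+ᵗ_ : Tensor → Tensor → Tensor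
    -ᵗ_  : Tensor → Tensor

  -- The least abelian group congruence making _⊗_ bilinear.
  data _≈ᵗ_ : Rel Tensor 0ℓ where
    reflᵗ      : ∀ {x} → x ≈ᵗ x
    symᵗ       : ∀ {x y} → x ≈ᵗ y → y ≈ᵗ x
    transᵗ     : ∀ {x y z} → x ≈ᵗ y → y ≈ᵗ z → x ≈ᵗ z
    +ᵗ-cong    : ∀ {x x′ y y′} → x ≈ᵗ x′ → y ≈ᵗ y′ → x +ᵗ y ≈ᵗ x′ +ᵗ y′
    -ᵗ-cong    : ∀ {x y} → x ≈ᵗ y → -ᵗ x ≈ᵗ -ᵗ y
    assocᵗ     : ∀ x y z → (x +ᵗ y) +ᵗ z ≈ᵗ x +ᵗ (y +ᵗ z)
    commᵗ      : ∀ x y → x +ᵗ y ≈ᵗ y +ᵗ x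
    identityˡᵗ : ∀ x → 0ᵗ +ᵗ x ≈ᵗ x
    inverseˡᵗ  : ∀ x → -ᵗ x +ᵗ x ≈ᵗ 0ᵗ
    ⊗-cong     : ∀ {a a′ b b′} → a A.≈ a′ → b B.≈ b′ → a ⊗ b ≈ᵗ a′ ⊗ b′
    ⊗-distribʳ : ∀ a a′ b → (a A.+ a′) ⊗ b ≈ᵗ a ⊗ b +ᵗ a′ ⊗ b
    ⊗-distribˡ : ∀ a b b′ → a ⊗ (b B.+ b′) ≈ᵗ a ⊗ b +ᵗ a ⊗ b′

  abelianGroup : AbelianGroup 0ℓ 0ℓ
  abelianGroup = record
    { Carrier = Tensor
    ; _≈_ = _≈ᵗ_
    ; _∙_ = _+ᵗ_
    ; ε = 0ᵗ
    ; _⁻¹ = -ᵗ_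
    ; isAbelianGroup = record
      { isGroup = record
        { isMonoid = record
          { isSemigroup = record
            { isMagma = record
              { isEquivalence = record { refl = reflᵗ ; sym = symᵗ ; trans = transᵗ }
              ; ∙-cong = +ᵗ-cong
              }
            ; assoc = assocᵗ
            }
          ; identity = identityˡᵗ , λ x → transᵗ (commᵗ x 0ᵗ) (identityˡᵗ x)
          }
        ; inverse = inverseˡᵗ , λ x → transᵗ (commᵗ x (-ᵗ x)) (inverseˡᵗ x)
        ; ⁻¹-cong = -ᵗ-cong
        }
      ; comm = commᵗ
      }
    }

  open Additive abelianGroup using (_·_)

  ·-⊗ˡ : ∀ k a b → (k A.· a) ⊗ b ≈ᵗ k · (a ⊗ b)
  ·-⊗ˡ k a b = additive-· {A} {abelianGroup} {_⊗ b}
    (λ e → ⊗-cong e B.≈-refl) (λ x y → ⊗-distribʳ x y b) k a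

  ·-⊗ʳ : ∀ k a b → a ⊗ (k B.· b) ≈ᵗ k · (a ⊗ b)
  ·-⊗ʳ k a b = additive-· {B} {abelianGroup} {a ⊗_}
    (⊗-cong A.≈-refl) (⊗-distribˡ a) k b

  -⊗ : ∀ a b → (A.- a) ⊗ b ≈ᵗ -ᵗ (a ⊗ b)
  -⊗ a b = additive-neg {A} {abelianGroup} {_⊗ b}
    (λ e → ⊗-cong e B.≈-refl) (λ x y → ⊗-distribʳ x y b) a

  0⊗ : ∀ b → A.0# ⊗ b ≈ᵗ 0ᵗ
  0⊗ b = additive-0 {A} {abelianGroup} {_⊗ b}
    (λ e → ⊗-cong e B.≈-refl) (λ x y → ⊗-distribʳ x y b)

  ⊗0 : ∀ a → a ⊗ B.0# ≈ᵗ 0ᵗ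
  ⊗0 a = additive-0 {B} {abelianGroup} {a ⊗_} (⊗-cong A.≈-refl) (⊗-distribˡ a)

infixl 7 _⊗ᴳ_

_⊗ᴳ_ : AbelianGroup 0ℓ 0ℓ → AbelianGroup 0ℓ 0ℓ → AbelianGroup 0ℓ 0ℓ
A ⊗ᴳ B = TensorProduct.abelianGroup A B

record IsAdditive (A B : AbelianGroup 0ℓ 0ℓ)
                  (f : AbelianGroup.Carrier A → AbelianGroup.Carrier B) : Set where
  private
    module A = Additive A
    module B = Additive B
  field
    f-cong : ∀ {x y} → x A.≈ y → f x B.≈ f y
    f-+    : ∀ x y → f (x A.+ y) B.≈ f x B.+ f y

  f-0 : f A.0# B.≈ B.0#
  f-0 = additive-0 {A} {B} {f} f-cong f-+

  f-neg : ∀ x → f (A.- x) B.≈ B.- f x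
  f-neg = additive-neg {A} {B} {f} f-cong f-+

  f-· : ∀ k x → f (k A.· x) B.≈ k B.· f x
  f-· = additive-· {A} {B} {f} f-cong f-+

id-additive : ∀ {A} → IsAdditive A A (λ x → x)
id-additive {A} = record { f-cong = λ e → e ; f-+ = λ _ _ → AbelianGroup.refl A }

∘-additive : ∀ {A B C f g} → IsAdditive B C g → IsAdditive A B f →
             IsAdditive A C (λ x → g (f x))
∘-additive {C = C} G F = record
  { f-cong = λ e → G.f-cong (F.f-cong e)
  ; f-+ = λ x y → AbelianGroup.trans C (G.f-cong (F.f-+ x y)) (G.f-+ _ _)
  }
  where
  module F = IsAdditive F
  module G = IsAdditive G

module _ {A B C : AbelianGroup 0ℓ 0ℓ} where
  open TensorProduct A B
  open Additive C

  tensor-ext : ∀ {f g} → IsAdditive (A ⊗ᴳ B) C f → IsAdditive (A ⊗ᴳ B) C g →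
               (∀ a b → f (a ⊗ b) ≈ g (a ⊗ b)) → ∀ x → f x ≈ g x
  tensor-ext {f} {g} hf hg e = go
    where
    module F = IsAdditive hf
    module G = IsAdditive hg
    go : ∀ x → f x ≈ g x
    go (a ⊗ b)  = e a b
    go 0ᵗ       = ≈-trans F.f-0 (≈-sym G.f-0)
    go (x +ᵗ y) = ≈-trans (F.f-+ x y)
      (≈-trans (+-cong (go x) (go y)) (≈-sym (G.f-+ x y)))
    go (-ᵗ x)   = ≈-trans (F.f-neg x)
      (≈-trans (-‿cong (go x)) (≈-sym (G.f-neg x)))

  record Bilinear : Set where
    private
      module A = Additive A
      module B = Additive B
    field
      β  : A.Carrier → B.Carrier → Carrier
      βˡ : ∀ b → IsAdditive A C (λ a → β a b)
      βʳ : ∀ a → IsAdditive B C (β a)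

  module _ (bil : Bilinear) where
    open Bilinear bil
    private
      module L {a} = IsAdditive (βʳ a)
      module R {b} = IsAdditive (βˡ b)

    liftBilinear : Tensor → Carrier
    liftBilinear (a ⊗ b)  = β a b
    liftBilinear 0ᵗ       = 0#
    liftBilinear (x +ᵗ y) = liftBilinear x + liftBilinear y
    liftBilinear (-ᵗ x)   = - liftBilinear x

    liftBilinear-cong : ∀ {x y} → x ≈ᵗ y → liftBilinear x ≈ liftBilinear y
    liftBilinear-cong reflᵗ               = ≈-refl
    liftBilinear-cong (symᵗ e)            = ≈-sym (liftBilinear-cong e)
    liftBilinear-cong (transᵗ d e)        =
      ≈-trans (liftBilinear-cong d) (liftBilinear-cong e)
    liftBilinear-cong (+ᵗ-cong d e)       =
      +-cong (liftBilinear-cong d) (liftBilinear-cong e)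
    liftBilinear-cong (-ᵗ-cong e)         = -‿cong (liftBilinear-cong e)
    liftBilinear-cong (assocᵗ x y z)      = +-assoc _ _ _
    liftBilinear-cong (commᵗ x y)         = +-comm _ _
    liftBilinear-cong (identityˡᵗ x)      = +-identityˡ _
    liftBilinear-cong (inverseˡᵗ x)       = -‿inverseˡ _
    liftBilinear-cong (⊗-cong d e)        = ≈-trans (R.f-cong d) (L.f-cong e)
    liftBilinear-cong (⊗-distribʳ a a′ b) = R.f-+ a a′
    liftBilinear-cong (⊗-distribˡ a b b′) = L.f-+ b b′

    liftBilinear-additive : IsAdditive (A ⊗ᴳ B) C liftBilinear
    liftBilinear-additive = record
      { f-cong = liftBilinear-cong ; f-+ = λ _ _ → ≈-refl }

module _ {A B C D : AbelianGroup 0ℓ 0ℓ} where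
  open TensorProduct A B
  private
    module C = Additive C
    module D = Additive D

  tensor-param : (h : Tensor → C.Carrier → D.Carrier) →
    (∀ c → IsAdditive (A ⊗ᴳ B) D (λ x → h x c)) →
    (∀ a b → IsAdditive C D (h (a ⊗ b))) →
    ∀ x → IsAdditive C D (h x)
  tensor-param h H K x = record
    { f-cong = λ {c} {c′} e → tensor-ext (H c) (H c′) (λ a b → IsAdditive.f-cong (K a b) e) x
    ; f-+ = λ c c′ → tensor-ext (H (c C.+ c′)) (sum-additive c c′)
        (λ a b → IsAdditive.f-+ (K a b) c c′) x
    }
    where
    open CommutativeSemigroupProperties D.commutativeSemigroup using (interchange)
    sum-additive : ∀ c c′ → IsAdditive (A ⊗ᴳ B) D (λ x → h x c D.+ h x c′)
    sum-additive c c′ = record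
      { f-cong = λ e → D.+-cong (IsAdditive.f-cong (H c) e) (IsAdditive.f-cong (H c′) e)
      ; f-+ = λ x y → D.≈-trans
          (D.+-cong (IsAdditive.f-+ (H c) x y) (IsAdditive.f-+ (H c′) x y))
          (interchange _ _ _ _)
      }

module _ {A B : AbelianGroup 0ℓ 0ℓ} where
  open TensorProduct A B

  ⊗-additiveˡ : ∀ b → IsAdditive A (A ⊗ᴳ B) (_⊗ b)
  ⊗-additiveˡ b = record
    { f-cong = λ e → ⊗-cong e (AbelianGroup.refl B)
    ; f-+ = λ a a′ → ⊗-distribʳ a a′ b }

  ⊗-additiveʳ : ∀ a → IsAdditive B (A ⊗ᴳ B) (a ⊗_)
  ⊗-additiveʳ a = record
    { f-cong = ⊗-cong (AbelianGroup.refl A) ; f-+ = ⊗-distribˡ a }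

mutuallyInverse⇒≅ : ∀ {A B f g} → IsAdditive A B f → IsAdditive B A g →
  (∀ y → AbelianGroup._≈_ B (f (g y)) y) →
  (∀ x → AbelianGroup._≈_ A (g (f x)) x) → A ≅ B
mutuallyInverse⇒≅ {A} {B} {f} {g} F G =
  mk≅ {A} {B} {f} (IsAdditive.f-cong F) (IsAdditive.f-+ F) g (IsAdditive.f-cong G)

⊗ᴳ-cong : ∀ {A A′ B B′} → A ≅ A′ → B ≅ B′ → A ⊗ᴳ B ≅ A′ ⊗ᴳ B′
⊗ᴳ-cong {A} {A′} {B} {B′} d e =
  mutuallyInverse⇒≅ {A ⊗ᴳ B} {A′ ⊗ᴳ B′}
    (liftBilinear-additive there) (liftBilinear-additive back)
    (tensor-ext
      (∘-additive {A′ ⊗ᴳ B′} {A ⊗ᴳ B} {A′ ⊗ᴳ B′}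
        (liftBilinear-additive there) (liftBilinear-additive back))
      (id-additive {A′ ⊗ᴳ B′})
      (λ a b → T′.⊗-cong (D.to-from a) (E.to-from b)))
    (tensor-ext
      (∘-additive {A ⊗ᴳ B} {A′ ⊗ᴳ B′} {A ⊗ᴳ B}
        (liftBilinear-additive back) (liftBilinear-additive there))
      (id-additive {A ⊗ᴳ B})
      (λ a b → T.⊗-cong (D.from-to a) (E.from-to b)))
  where
  module T = TensorProduct A B
  module T′ = TensorProduct A′ B′
  module D = Inverses (≅⇒Inverses {A} {A′} d)
  module E = Inverses (≅⇒Inverses {B} {B′} e)

  there : Bilinear {A} {B} {A′ ⊗ᴳ B′}
  there = record
    { β = λ a b → D.to a T′.⊗ E.to b
    ; βˡ = λ b → ∘-additive {A} {A′} {A′ ⊗ᴳ B′}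
        (⊗-additiveˡ (E.to b)) (record { f-cong = D.to-cong ; f-+ = D.to-+ })
    ; βʳ = λ a → ∘-additive {B} {B′} {A′ ⊗ᴳ B′}
        (⊗-additiveʳ (D.to a)) (record { f-cong = E.to-cong ; f-+ = E.to-+ })
    }

  back : Bilinear {A′} {B′} {A ⊗ᴳ B}
  back = record
    { β = λ a b → D.from a T.⊗ E.from b
    ; βˡ = λ b → ∘-additive {A′} {A} {A ⊗ᴳ B}
        (⊗-additiveˡ (E.from b)) (record { f-cong = D.from-cong ; f-+ = D.from-+ })
    ; βʳ = λ a → ∘-additive {B′} {B} {A ⊗ᴳ B}
        (⊗-additiveʳ (D.from a)) (record { f-cong = E.from-cong ; f-+ = E.from-+ })
    }

⊗ᴳ-comm : ∀ A B → A ⊗ᴳ B ≅ B ⊗ᴳ A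
⊗ᴳ-comm A B = mutuallyInverse⇒≅ {A ⊗ᴳ B} {B ⊗ᴳ A}
  (liftBilinear-additive (swap A B)) (liftBilinear-additive (swap B A))
  (swap-swap B A) (swap-swap A B)
  where
  swap : ∀ A B → Bilinear {A} {B} {B ⊗ᴳ A}
  swap A B = record
    { β = λ a b → TensorProduct._⊗_ b a ; βˡ = ⊗-additiveʳ ; βʳ = ⊗-additiveˡ }

  swap-swap : ∀ A B x → AbelianGroup._≈_ (A ⊗ᴳ B)
    (liftBilinear (swap B A) (liftBilinear (swap A B) x)) x
  swap-swap A B = tensor-ext
    (∘-additive {A ⊗ᴳ B} {B ⊗ᴳ A} {A ⊗ᴳ B}
      (liftBilinear-additive (swap B A)) (liftBilinear-additive (swap A B)))
    (id-additive {A ⊗ᴳ B})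
    (λ a b → TensorProduct.reflᵗ)

⊗ᴳ-assoc : ∀ A B C → (A ⊗ᴳ B) ⊗ᴳ C ≅ A ⊗ᴳ (B ⊗ᴳ C)
⊗ᴳ-assoc A B C = mutuallyInverse⇒≅ {L} {R}
  (liftBilinear-additive there) (liftBilinear-additive back)
  (tensor-ext
    (∘-additive {R} {L} {R} (liftBilinear-additive there) (liftBilinear-additive back))
    (id-additive {R})
    (λ a → tensor-ext
      (∘-additive {B ⊗ᴳ C} {R} {R}
        (∘-additive {R} {L} {R} (liftBilinear-additive there) (liftBilinear-additive back))
        (⊗-additiveʳ a))
      (⊗-additiveʳ a)
      (λ b c → TR.reflᵗ)))
  (tensor-ext
    (∘-additive {L} {R} {L} (liftBilinear-additive back) (liftBilinear-additive there))
    (id-additive {L})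
    (λ x c → tensor-ext
      (∘-additive {A ⊗ᴳ B} {L} {L}
        (∘-additive {L} {R} {L} (liftBilinear-additive back) (liftBilinear-additive there))
        (⊗-additiveˡ c))
      (⊗-additiveˡ c)
      (λ a b → TL.reflᵗ) x))
  where
  L = (A ⊗ᴳ B) ⊗ᴳ C
  R = A ⊗ᴳ (B ⊗ᴳ C)
  module AB = TensorProduct A B
  module BC = TensorProduct B C
  module TL = TensorProduct (A ⊗ᴳ B) C
  module TR = TensorProduct A (B ⊗ᴳ C)

  pushʳ : AbelianGroup.Carrier C → Bilinear {A} {B} {R}
  pushʳ c = record
    { β = λ a b → a TR.⊗ (b BC.⊗ c)
    ; βˡ = λ b → ⊗-additiveˡ (b BC.⊗ c)
    ; βʳ = λ a → ∘-additive {B} {B ⊗ᴳ C} {R} (⊗-additiveʳ a) (⊗-additiveˡ c)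
    }

  there : Bilinear {A ⊗ᴳ B} {C} {R}
  there = record
    { β = λ x c → liftBilinear (pushʳ c) x
    ; βˡ = λ c → liftBilinear-additive (pushʳ c)
    ; βʳ = tensor-param (λ x c → liftBilinear (pushʳ c) x)
        (λ c → liftBilinear-additive (pushʳ c))
        (λ a b → ∘-additive {C} {B ⊗ᴳ C} {R} (⊗-additiveʳ a) (⊗-additiveʳ b))
    }

  pushˡ : AbelianGroup.Carrier A → Bilinear {B} {C} {L}
  pushˡ a = record
    { β = λ b c → (a AB.⊗ b) TL.⊗ c
    ; βˡ = λ c → ∘-additive {B} {A ⊗ᴳ B} {L} (⊗-additiveˡ c) (⊗-additiveʳ a)
    ; βʳ = λ b → ⊗-additiveʳ (a AB.⊗ b)
    }

  back : Bilinear {A} {B ⊗ᴳ C} {L}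
  back = record
    { β = λ a x → liftBilinear (pushˡ a) x
    ; βˡ = tensor-param (λ x a → liftBilinear (pushˡ a) x)
        (λ a → liftBilinear-additive (pushˡ a))
        (λ b c → ∘-additive {A} {A ⊗ᴳ B} {L} (⊗-additiveˡ c) (⊗-additiveˡ b))
    ; βʳ = λ a → liftBilinear-additive (pushˡ a)
    }

ℤᴳ : AbelianGroup 0ℓ 0ℓ
ℤᴳ = ℤ.+-0-abelianGroup

ℤ-×ₙ : ∀ n l → Additive._×ₙ_ ℤᴳ n l ≡ + n ℤ.* l
ℤ-×ₙ zero    l = sym (ℤ.*-zeroˡ l)
ℤ-×ₙ (suc n) l = trans (cong (λ t → l ℤ.+ t) (ℤ-×ₙ n l)) (sym (ℤ.suc-* (+ n) l))

ℤ-· : ∀ k l → Additive._·_ ℤᴳ k l ≡ k ℤ.* l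
ℤ-· (+ n)    l = ℤ-×ₙ n l
ℤ-· -[1+ n ] l = trans (cong ℤ.-_ (ℤ-×ₙ (suc n) l)) (ℤ.neg-distribˡ-* (+ suc n) l)

⊗ᴳ-identityˡ : ∀ A → ℤᴳ ⊗ᴳ A ≅ A
⊗ᴳ-identityˡ A = mutuallyInverse⇒≅ {ℤᴳ ⊗ᴳ A} {A}
  (liftBilinear-additive scale) (⊗-additiveʳ 1ℤ)
  ·-identity
  (tensor-ext
    (∘-additive {ℤᴳ ⊗ᴳ A} {A} {ℤᴳ ⊗ᴳ A} (⊗-additiveʳ 1ℤ) (liftBilinear-additive scale))
    (id-additive {ℤᴳ ⊗ᴳ A})
    (λ k a → transᵗ (·-⊗ʳ k 1ℤ a) (transᵗ (symᵗ (·-⊗ˡ k 1ℤ a))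
      (⊗-cong (trans (ℤ-· k 1ℤ) (ℤ.*-identityʳ k)) (AbelianGroup.refl A)))))
  where
  open TensorProduct ℤᴳ A
  open Additive A
  open MultipleProperties A

  scale : Bilinear {ℤᴳ} {A} {A}
  scale = record
    { β = _·_
    ; βˡ = λ a → record { f-cong = ·-congʳ a ; f-+ = λ k l → ·-distribʳ k l a }
    ; βʳ = λ k → record { f-cong = ·-congˡ k ; f-+ = ·-distribˡ k }
    }

abs-unit : ∀ i → ∃ λ s → + ℤ.∣ i ∣ ≡ s ℤ.* i
abs-unit (+ n)    = 1ℤ , sym (ℤ.*-identityˡ (+ n))
abs-unit -[1+ n ] = ℤ.-1ℤ , sym (ℤ.-1*i≡-i -[1+ n ])

bezout-ℕ : ∀ m n → ∃ λ u → ∃ λ v → + ℕ.gcd m n ≡ u ℤ.* + m ℤ.+ v ℤ.* + n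
bezout-ℕ m n with ℕ.Bézout.identity (ℕ.gcd-GCD m n)
... | ℕ.Bézout.+- x y eq = + x , ℤ.- (+ y) , solution (+ ℕ.gcd m n) (+ x) (+ y) (+ m) (+ n) (begin
  + ℕ.gcd m n ℤ.+ + y ℤ.* + n  ≡⟨ cong (λ t → + ℕ.gcd m n ℤ.+ t) (ℤ.pos-* y n) ⟨
  + (ℕ.gcd m n ℕ.+ y ℕ.* n)    ≡⟨ cong +_ eq ⟩
  + (x ℕ.* m)                  ≡⟨ ℤ.pos-* x m ⟩
  + x ℤ.* + m                  ∎)
  where
  open ≡-Reasoning
  solution : ∀ g x y m n → g ℤ.+ y ℤ.* n ≡ x ℤ.* m → g ≡ x ℤ.* m ℤ.+ (ℤ.- y) ℤ.* n
  solution g x y m n e = trans (ring g y n) (cong (λ t → t ℤ.+ (ℤ.- y) ℤ.* n) e)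
    where
    ring : ∀ g y n → g ≡ (g ℤ.+ y ℤ.* n) ℤ.+ (ℤ.- y) ℤ.* n
    ring = solve-∀
... | ℕ.Bézout.-+ x y eq = ℤ.- (+ x) , + y , solution (+ ℕ.gcd m n) (+ x) (+ y) (+ m) (+ n) (begin
  + ℕ.gcd m n ℤ.+ + x ℤ.* + m  ≡⟨ cong (λ t → + ℕ.gcd m n ℤ.+ t) (ℤ.pos-* x m) ⟨
  + (ℕ.gcd m n ℕ.+ x ℕ.* m)    ≡⟨ cong +_ eq ⟩
  + (y ℕ.* n)                  ≡⟨ ℤ.pos-* y n ⟩
  + y ℤ.* + n                  ∎)
  where
  open ≡-Reasoning
  solution : ∀ g x y m n → g ℤ.+ x ℤ.* m ≡ y ℤ.* n → g ≡ (ℤ.- x) ℤ.* m ℤ.+ y ℤ.* n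
  solution g x y m n e = trans (ring g x m) (cong (λ t → (ℤ.- x) ℤ.* m ℤ.+ t) e)
    where
    ring : ∀ g x m → g ≡ (ℤ.- x) ℤ.* m ℤ.+ (g ℤ.+ x ℤ.* m)
    ring = solve-∀

bezout : ∀ i j → ∃ λ g → ∃ λ x → ∃ λ y → ∃ λ u → ∃ λ v →
  i ≡ g ℤ.* x × j ≡ g ℤ.* y × g ≡ g ℤ.* (u ℤ.* x ℤ.+ v ℤ.* y)
bezout i j
  with abs-unit i | abs-unit j | bezout-ℕ ℤ.∣ i ∣ ℤ.∣ j ∣
     | ℤ∣.∣ᵤ⇒∣ {+ ℕ.gcd ℤ.∣ i ∣ ℤ.∣ j ∣} {i} (ℕ.gcd[m,n]∣m ℤ.∣ i ∣ ℤ.∣ j ∣)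
     | ℤ∣.∣ᵤ⇒∣ {+ ℕ.gcd ℤ.∣ i ∣ ℤ.∣ j ∣} {j} (ℕ.gcd[m,n]∣n ℤ.∣ i ∣ ℤ.∣ j ∣)
... | s , s≡ | t , t≡ | u , v , e | ℤ∣.divides x i≡ | ℤ∣.divides y j≡ =
  g , x , y , u ℤ.* s , v ℤ.* t ,
  trans i≡ (ℤ.*-comm x g) , trans j≡ (ℤ.*-comm y g) , (begin
    g                                                          ≡⟨ e ⟩
    u ℤ.* + ℤ.∣ i ∣ ℤ.+ v ℤ.* + ℤ.∣ j ∣                        ≡⟨ cong₂ (λ p q → u ℤ.* p ℤ.+ v ℤ.* q) s≡ t≡ ⟩
    u ℤ.* (s ℤ.* i) ℤ.+ v ℤ.* (t ℤ.* j)                        ≡⟨ cong₂ (λ p q → u ℤ.* (s ℤ.* p) ℤ.+ v ℤ.* (t ℤ.* q)) i≡ j≡ ⟩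
    u ℤ.* (s ℤ.* (x ℤ.* g)) ℤ.+ v ℤ.* (t ℤ.* (y ℤ.* g))        ≡⟨ ring u v s t x y g ⟩
    g ℤ.* (u ℤ.* s ℤ.* x ℤ.+ v ℤ.* t ℤ.* y)                    ∎)
  where
  open ≡-Reasoning
  g = + ℕ.gcd ℤ.∣ i ∣ ℤ.∣ j ∣
  ring : ∀ u v s t x y g →
    u ℤ.* (s ℤ.* (x ℤ.* g)) ℤ.+ v ℤ.* (t ℤ.* (y ℤ.* g)) ≡
    g ℤ.* (u ℤ.* s ℤ.* x ℤ.+ v ℤ.* t ℤ.* y)
  ring = solve-∀

ℚᴳ : AbelianGroup 0ℓ 0ℓ
ℚᴳ = ℚᵘ.+-0-abelianGroup

↥≡0⇒≃0 : ∀ q → ℚᵘ.↥ q ≡ 0ℤ → q ≃ 0ℚᵘ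
↥≡0⇒≃0 (mkℚᵘ n d) refl = *≡* refl

≃0⇒↥≡0 : ∀ q → q ≃ 0ℚᵘ → ℚᵘ.↥ q ≡ 0ℤ
≃0⇒↥≡0 (mkℚᵘ n d) (*≡* e) = trans (sym (ℤ.*-identityʳ n)) e

ℚᵘ-zero-product : ∀ p q → p ℚᵘ.* q ≃ 0ℚᵘ → p ≃ 0ℚᵘ ⊎ q ≃ 0ℚᵘ
ℚᵘ-zero-product p@record{} q@record{} e
  with ℤ.i*j≡0⇒i≡0∨j≡0 (ℚᵘ.↥ p) (≃0⇒↥≡0 _ e)
... | inj₁ p≡0 = inj₁ (↥≡0⇒≃0 p p≡0)
... | inj₂ q≡0 = inj₂ (↥≡0⇒≃0 q q≡0)

ℤ→ℚᵘ : ℤ → ℚᵘ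
ℤ→ℚᵘ k = mkℚᵘ k 0

ℤ→ℚᵘ-additive : IsAdditive ℤᴳ ℚᴳ ℤ→ℚᵘ
ℤ→ℚᵘ-additive = record
  { f-cong = λ { refl → ℚᵘ.≃-refl }
  ; f-+ = λ k l → *≡* (lemma k l)
  }
  where
  lemma : ∀ k l → (k ℤ.+ l) ℤ.* 1ℤ ≡ (k ℤ.* 1ℤ ℤ.+ l ℤ.* 1ℤ) ℤ.* 1ℤ
  lemma = solve-∀

*-additiveˡ : ∀ q → IsAdditive ℚᴳ ℚᴳ (λ p → p ℚᵘ.* q)
*-additiveˡ q = record { f-cong = ℚᵘ.*-congʳ ; f-+ = ℚᵘ.*-distribʳ-+ q }

*-additiveʳ : ∀ p → IsAdditive ℚᴳ ℚᴳ (λ q → p ℚᵘ.* q)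
*-additiveʳ p = record { f-cong = ℚᵘ.*-congˡ {p} ; f-+ = ℚᵘ.*-distribˡ-+ p }

ℚᵘ-· : ∀ k q → Additive._·_ ℚᴳ k q ≃ ℤ→ℚᵘ k ℚᵘ.* q
ℚᵘ-· k q = begin
  k · q                               ≈⟨ ·-congˡ k (ℚᵘ.*-identityˡ q) ⟨
  k · (ℤ→ℚᵘ 1ℤ ℚᵘ.* q)                ≈⟨ IsAdditive.f-· h k 1ℤ ⟨
  ℤ→ℚᵘ (Additive._·_ ℤᴳ k 1ℤ) ℚᵘ.* q  ≈⟨ IsAdditive.f-cong h
                                           (trans (ℤ-· k 1ℤ) (ℤ.*-identityʳ k)) ⟩
  ℤ→ℚᵘ k ℚᵘ.* q                       ∎
  where
  open Additive ℚᴳ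
  open MultipleProperties ℚᴳ
  open SetoidReasoning setoid
  h : IsAdditive ℤᴳ ℚᴳ (λ k → ℤ→ℚᵘ k ℚᵘ.* q)
  h = ∘-additive {ℤᴳ} {ℚᴳ} {ℚᴳ} (*-additiveˡ q) ℤ→ℚᵘ-additive

ℚᵘ-·-zero : ∀ k q → Additive._·_ ℚᴳ k q ≃ 0ℚᵘ → k ≡ 0ℤ ⊎ q ≃ 0ℚᵘ
ℚᵘ-·-zero k q e
  with ℚᵘ-zero-product (ℤ→ℚᵘ k) q (ℚᵘ.≃-trans (ℚᵘ.≃-sym (ℚᵘ-· k q)) e)
... | inj₁ k≃0 = inj₁ (≃0⇒↥≡0 (ℤ→ℚᵘ k) k≃0)
... | inj₂ q≃0 = inj₂ q≃0

-- A torsion-free group has rank 1 iff it is a nonzero subgroup of ℚ; this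
-- form of the condition is used to see that it is preserved by _⊗ᴳ_.
record NonzeroEmbedding (A : AbelianGroup 0ℓ 0ℓ) : Set where
  open Additive A
  field
    φ          : Carrier → ℚᵘ
    additive   : IsAdditive A ℚᴳ φ
    φ≃0⇒≈0     : ∀ a → φ a ≃ 0ℚᵘ → a ≈ 0#
    a₀         : Carrier
    φa₀≄0      : φ a₀ ≃ 0ℚᵘ → ⊥

  open IsAdditive additive public
    renaming (f-cong to φ-cong; f-+ to φ-+; f-0 to φ-0; f-neg to φ-neg; f-· to φ-·)

module _ {A : AbelianGroup 0ℓ 0ℓ} (emb : NonzeroEmbedding A) where
  open Additive A
  open MultipleProperties A
  open NonzeroEmbedding emb

  private
    φ-·-zero : ∀ k a → k · a ≈ 0# → k ≡ 0ℤ ⊎ φ a ≃ 0ℚᵘ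
    φ-·-zero k a e = ℚᵘ-·-zero k (φ a)
      (ℚᵘ.≃-trans (ℚᵘ.≃-sym (φ-· k a)) (ℚᵘ.≃-trans (φ-cong e) φ-0))

  embedding⇒torsionFree : TorsionFree
  embedding⇒torsionFree k a k≢0 e with φ-·-zero k a e
  ... | inj₁ k≡0  = ⊥-elim (k≢0 k≡0)
  ... | inj₂ φa≃0 = φ≃0⇒≈0 a φa≃0

  embedding⇒rank1 : HasRank 1
  embedding⇒rank1 = (λ _ → a₀) , independent , dependent
    where
    independent : LinearlyIndependent {1} (λ _ → a₀)
    independent c e zero with φ-·-zero (c zero) a₀ (≈-trans (≈-sym (+-identityʳ _)) e)
    ... | inj₁ c≡0 = c≡0
    ... | inj₂ φa₀≃0 = ⊥-elim (φa₀≄0 φa₀≃0)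

    m₀ = ℚᵘ.↥ (φ a₀)
    d₀ = ℚᵘ.↧ (φ a₀)

    coefficients : Carrier → Vector ℤ 2
    coefficients a zero       = m₀ ℤ.* ℚᵘ.↧ (φ a)
    coefficients a (suc zero) = ℤ.- (ℚᵘ.↥ (φ a) ℤ.* d₀)

    dependent : ∀ a → LinearlyDependent (a ∷ λ _ → a₀)
    dependent a = coefficients a , (zero , k≢0) , φ≃0⇒≈0 _ (begin
      φ (k · a + (l · a₀ + 0#))           ≈⟨ φ-cong (+-congˡ (+-identityʳ _)) ⟩
      φ (k · a + l · a₀)                  ≈⟨ φ-+ _ _ ⟩
      φ (k · a) ℚᵘ.+ φ (l · a₀)           ≈⟨ ℚᵘ.+-cong (φ-· k a) (φ-· l a₀) ⟩
      (k Q.· φ a) ℚᵘ.+ (l Q.· φ a₀)       ≈⟨ ℚᵘ.+-cong (ℚᵘ-· k (φ a)) (ℚᵘ-· l (φ a₀)) ⟩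
      ℤ→ℚᵘ k ℚᵘ.* φ a ℚᵘ.+ ℤ→ℚᵘ l ℚᵘ.* φ a₀ ≈⟨ cancel (φ a) (φ a₀) ⟩
      0ℚᵘ                                 ∎)
      where
      module Q = Additive ℚᴳ
      open SetoidReasoning Q.setoid
      k = coefficients a zero
      l = coefficients a (suc zero)

      k≢0 : k ≢ 0ℤ
      k≢0 e with ℤ.i*j≡0⇒i≡0∨j≡0 m₀ e
      ... | inj₁ m₀≡0 = φa₀≄0 (↥≡0⇒≃0 (φ a₀) m₀≡0)

      cancel : ∀ p q →
        ℤ→ℚᵘ (ℚᵘ.↥ q ℤ.* ℚᵘ.↧ p) ℚᵘ.* p ℚᵘ.+
        ℤ→ℚᵘ (ℤ.- (ℚᵘ.↥ p ℤ.* ℚᵘ.↧ q)) ℚᵘ.* q ≃ 0ℚᵘ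
      cancel (mkℚᵘ m d) (mkℚᵘ n e) = ↥≡0⇒≃0 _ (trans
        (cong₂ (λ s t → (n ℤ.* + suc d) ℤ.* m ℤ.* + suc s ℤ.+
                        (ℤ.- (m ℤ.* + suc e)) ℤ.* n ℤ.* + suc t)
          (ℕ.+-identityʳ e) (ℕ.+-identityʳ d))
        (ring m n (+ suc d) (+ suc e)))
        where
        ring : ∀ m n d e →
          n ℤ.* d ℤ.* m ℤ.* e ℤ.+ (ℤ.- (m ℤ.* e)) ℤ.* n ℤ.* d ≡ 0ℤ
        ring = solve-∀

module Rank1 (A : AbelianGroup 0ℓ 0ℓ) (torsionFree : Additive.TorsionFree A)
             (rank1 : Additive.HasRank A 1) where
  open Additive A
  open MultipleProperties A
  open GroupProperties group using (inverseˡ-unique; x≈y⇒x∙y⁻¹≈ε; ⁻¹-injective)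

  generator : Carrier
  generator = proj₁ rank1 zero

  generator-free : ∀ k → k · generator ≈ 0# → k ≡ 0ℤ
  generator-free k e =
    proj₁ (proj₂ rank1) (λ _ → k) (≈-trans (+-identityʳ _) e) zero

  generator-cancel : ∀ k l → k · generator ≈ l · generator → k ≡ l
  generator-cancel k l e = ℤ.i-j≡0⇒i≡j k l (generator-free _ (begin
    (k ℤ.- l) · generator                  ≈⟨ ·-distribʳ k (ℤ.- l) generator ⟩
    k · generator + (ℤ.- l) · generator    ≈⟨ +-congˡ (-‿· l generator) ⟩
    k · generator + - (l · generator)      ≈⟨ x≈y⇒x∙y⁻¹≈ε e ⟩
    0#                                     ∎))
    where open SetoidReasoning setoid

  ratio : ∀ a → ∃ λ m → ∃ λ d → (+ suc d) · a ≈ m · generator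
  ratio a with proj₂ (proj₂ rank1) a
  ... | c , (i , cᵢ≢0) , e = go (c zero) (c (suc zero)) refl refl
    (≈-trans (+-congˡ (≈-sym (+-identityʳ _))) e)
    where
    absurd : c zero ≡ 0ℤ → c (suc zero) ≡ 0ℤ → ∀ i → c i ≢ 0ℤ → ⊥
    absurd p q zero       n = n p
    absurd p q (suc zero) n = n q

    go : ∀ k l → c zero ≡ k → c (suc zero) ≡ l → k · a + l · generator ≈ 0# →
         ∃ λ m → ∃ λ d → (+ suc d) · a ≈ m · generator
    go (+ zero) l p q e = ⊥-elim (absurd p
      (trans q (generator-free l (≈-trans (≈-sym (+-identityˡ _)) e))) i cᵢ≢0)
    go (+ suc d) l _ _ e = ℤ.- l , d ,
      ≈-trans (inverseˡ-unique _ _ e) (≈-sym (-‿· l generator))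
    go -[1+ d ] l _ _ e = l , d , ⁻¹-injective (inverseˡ-unique _ _ e)

  fraction : Carrier → ℚᵘ
  fraction a = mkℚᵘ (proj₁ (ratio a)) (proj₁ (proj₂ (ratio a)))

  fraction-unique : ∀ a m d n e → (+ suc d) · a ≈ m · generator →
    (+ suc e) · a ≈ n · generator → mkℚᵘ m d ≃ mkℚᵘ n e
  fraction-unique a m d n e p q = *≡* (generator-cancel _ _ (begin
    (m ℤ.* + suc e) · generator    ≈⟨ ·-congʳ _ (ℤ.*-comm m _) ⟩
    (+ suc e ℤ.* m) · generator    ≈⟨ ·-assoc (+ suc e) m _ ⟩
    (+ suc e) · m · generator      ≈⟨ ·-congˡ (+ suc e) p ⟨
    (+ suc e) · (+ suc d) · a      ≈⟨ ·-swap (+ suc e) (+ suc d) a ⟩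
    (+ suc d) · (+ suc e) · a      ≈⟨ ·-congˡ (+ suc d) q ⟩
    (+ suc d) · n · generator      ≈⟨ ·-assoc (+ suc d) n _ ⟨
    (+ suc d ℤ.* n) · generator    ≈⟨ ·-congʳ _ (ℤ.*-comm (+ suc d) n) ⟩
    (n ℤ.* + suc d) · generator    ∎))
    where open SetoidReasoning setoid

  fraction-ratio : ∀ a m d → (+ suc d) · a ≈ m · generator → fraction a ≃ mkℚᵘ m d
  fraction-ratio a m d = fraction-unique a _ _ m d (proj₂ (proj₂ (ratio a)))

  fraction-cong : ∀ {a b} → a ≈ b → fraction a ≃ fraction b
  fraction-cong {a} {b} a≈b with ratio b
  ... | m , d , e = fraction-ratio a m d (≈-trans (·-congˡ (+ suc d) a≈b) e)

  fraction-+ : ∀ a b → fraction (a + b) ≃ fraction a ℚᵘ.+ fraction b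
  fraction-+ a b with ratio a | ratio b
  ... | m , d , p | n , e , q = fraction-ratio (a + b) _ _ (begin
    (D ℤ.* E) · (a + b)                                    ≈⟨ ·-distribˡ (D ℤ.* E) a b ⟩
    (D ℤ.* E) · a + (D ℤ.* E) · b                          ≈⟨ +-cong left right ⟩
    (m ℤ.* E) · generator + (n ℤ.* D) · generator          ≈⟨ ·-distribʳ (m ℤ.* E) (n ℤ.* D) _ ⟨
    (m ℤ.* E ℤ.+ n ℤ.* D) · generator                      ∎)
    where
    open SetoidReasoning setoid
    D = + suc d
    E = + suc e
    left : (D ℤ.* E) · a ≈ (m ℤ.* E) · generator
    left = begin
      (D ℤ.* E) · a          ≈⟨ ·-congʳ a (ℤ.*-comm D E) ⟩
      (E ℤ.* D) · a          ≈⟨ ·-assoc E D a ⟩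
      E · D · a              ≈⟨ ·-congˡ E p ⟩
      E · m · generator      ≈⟨ ·-assoc E m _ ⟨
      (E ℤ.* m) · generator  ≈⟨ ·-congʳ _ (ℤ.*-comm E m) ⟩
      (m ℤ.* E) · generator  ∎
    right : (D ℤ.* E) · b ≈ (n ℤ.* D) · generator
    right = begin
      (D ℤ.* E) · b          ≈⟨ ·-assoc D E b ⟩
      D · E · b              ≈⟨ ·-congˡ D q ⟩
      D · n · generator      ≈⟨ ·-assoc D n _ ⟨
      (D ℤ.* n) · generator  ≈⟨ ·-congʳ _ (ℤ.*-comm D n) ⟩
      (n ℤ.* D) · generator  ∎

  fraction-0 : ∀ a → fraction a ≃ 0ℚᵘ → a ≈ 0#
  fraction-0 a q with ratio a
  ... | m , d , e = torsionFree (+ suc d) a (λ ())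
    (≈-trans e (·-congʳ generator (≃0⇒↥≡0 (mkℚᵘ m d) q)))

  embedding : NonzeroEmbedding A
  embedding = record
    { φ = fraction
    ; additive = record { f-cong = fraction-cong ; f-+ = fraction-+ }
    ; φ≃0⇒≈0 = fraction-0
    ; a₀ = generator
    ; φa₀≄0 = λ q → one≄0 (ℚᵘ.≃-trans
        (ℚᵘ.≃-sym (fraction-ratio generator 1ℤ 0 ≈-refl)) q)
    }
    where
    one≄0 : mkℚᵘ 1ℤ 0 ≃ 0ℚᵘ → ⊥
    one≄0 (*≡* ())

  common-generator : ∀ a b → ∃ λ c → ∃ λ k → ∃ λ l → a ≈ k · c × b ≈ l · c
  common-generator a b with ratio a | ratio b
  ... | m , d , p | n , e , q =
    go (bezout (n ℤ.* + suc d) (m ℤ.* + suc e))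
    where
    open SetoidReasoning setoid

    relation : (n ℤ.* + suc d) · a ≈ (m ℤ.* + suc e) · b
    relation = begin
      (n ℤ.* + suc d) · a     ≈⟨ ·-assoc n (+ suc d) a ⟩
      n · (+ suc d) · a       ≈⟨ ·-congˡ n p ⟩
      n · m · generator       ≈⟨ ·-swap n m generator ⟩
      m · n · generator       ≈⟨ ·-congˡ m q ⟨
      m · (+ suc e) · b       ≈⟨ ·-assoc m (+ suc e) b ⟨
      (m ℤ.* + suc e) · b     ∎

    go : (∃ λ g → ∃ λ x → ∃ λ y → ∃ λ u → ∃ λ v →
           n ℤ.* + suc d ≡ g ℤ.* x × m ℤ.* + suc e ≡ g ℤ.* y ×
           g ≡ g ℤ.* (u ℤ.* x ℤ.+ v ℤ.* y)) →
         ∃ λ c → ∃ λ k → ∃ λ l → a ≈ k · c × b ≈ l · c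
    go (g , x , y , u , v , nd≡ , me≡ , g≡) with g ℤ.≟ 0ℤ
    ... | yes refl = 0# , 0ℤ , 0ℤ ,
      torsionFree (+ suc d) a (λ ()) (≈-trans p (·-congʳ generator (zero-factor m e {y} me≡))) ,
      torsionFree (+ suc e) b (λ ()) (≈-trans q (·-congʳ generator (zero-factor n d {x} nd≡)))
      where
      zero-factor : ∀ i j {z} → i ℤ.* + suc j ≡ 0ℤ ℤ.* z → i ≡ 0ℤ
      zero-factor i j e with ℤ.i*j≡0⇒i≡0∨j≡0 i e
      ... | inj₁ i≡0 = i≡0
    ... | no g≢0 = u · b + v · a , y , x , a≈ , b≈
      where
      xa≈yb : x · a ≈ y · b
      xa≈yb = ·-cancel torsionFree g g≢0 (begin
        g · x · a               ≈⟨ ·-assoc g x a ⟨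
        (g ℤ.* x) · a           ≈⟨ ·-congʳ a nd≡ ⟨
        (n ℤ.* + suc d) · a     ≈⟨ relation ⟩
        (m ℤ.* + suc e) · b     ≈⟨ ·-congʳ b me≡ ⟩
        (g ℤ.* y) · b           ≈⟨ ·-assoc g y b ⟩
        g · y · b               ∎)

      ux+vy≡1 : u ℤ.* x ℤ.+ v ℤ.* y ≡ 1ℤ
      ux+vy≡1 = sym (ℤ.*-cancelˡ-≡ g 1ℤ _ {{ℤ.≢-nonZero g≢0}}
        (trans (ℤ.*-identityʳ g) g≡))

      one : ∀ t → (u ℤ.* x) · t + (v ℤ.* y) · t ≈ t
      one t = begin
        (u ℤ.* x) · t + (v ℤ.* y) · t  ≈⟨ ·-distribʳ (u ℤ.* x) (v ℤ.* y) t ⟨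
        (u ℤ.* x ℤ.+ v ℤ.* y) · t      ≈⟨ ·-congʳ t ux+vy≡1 ⟩
        1ℤ · t                         ≈⟨ ·-identity t ⟩
        t                              ∎

      a≈ : a ≈ y · (u · b + v · a)
      a≈ = begin
        a                              ≈⟨ one a ⟨
        (u ℤ.* x) · a + (v ℤ.* y) · a  ≈⟨ +-cong (·-assoc u x a) (·-assoc v y a) ⟩
        u · x · a + v · y · a          ≈⟨ +-cong (·-congˡ u xa≈yb) (·-swap v y a) ⟩
        u · y · b + y · v · a          ≈⟨ +-congʳ (·-swap u y b) ⟩
        y · u · b + y · v · a          ≈⟨ ·-distribˡ y _ _ ⟨
        y · (u · b + v · a)            ∎

      b≈ : b ≈ x · (u · b + v · a)
      b≈ = begin
        b                              ≈⟨ one b ⟨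
        (u ℤ.* x) · b + (v ℤ.* y) · b  ≈⟨ +-cong (·-assoc u x b) (·-assoc v y b) ⟩
        u · x · b + v · y · b          ≈⟨ +-cong (·-swap u x b) (·-congˡ v (≈-sym xa≈yb)) ⟩
        x · u · b + v · x · a          ≈⟨ +-congˡ (·-swap v x a) ⟩
        x · u · b + x · v · a          ≈⟨ ·-distribˡ x _ _ ⟨
        x · (u · b + v · a)            ∎

record RankOneGroup : Set₁ where
  field
    abelianGroup : AbelianGroup 0ℓ 0ℓ
  open Additive abelianGroup
  field
    torsionFree : TorsionFree
    rank1       : HasRank 1

  open Rank1 abelianGroup torsionFree rank1 public
    using (embedding; common-generator)

open RankOneGroup using (abelianGroup)

fromEmbedding : ∀ {A} → NonzeroEmbedding A → RankOneGroup
fromEmbedding {A} emb = record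
  { abelianGroup = A
  ; torsionFree = embedding⇒torsionFree emb
  ; rank1 = embedding⇒rank1 emb
  }

module _ (L M : RankOneGroup) where
  private
    A = abelianGroup L
    B = abelianGroup M
    module A = Additive A
    module B = Additive B
    module L = RankOneGroup L
    module EA = NonzeroEmbedding L.embedding
    module EB = NonzeroEmbedding (RankOneGroup.embedding M)
  open TensorProduct A B
  open SetoidReasoning (Additive.setoid (A ⊗ᴳ B))

  pure-+ : ∀ {a a′} b b′ → (∃ λ c → ∃ λ k → ∃ λ l → a A.≈ k A.· c × a′ A.≈ l A.· c) →
           ∃ λ c → ∃ λ d → a ⊗ b +ᵗ a′ ⊗ b′ ≈ᵗ c ⊗ d
  pure-+ {a} {a′} b b′ (c , k , l , p , q) = c , k B.· b B.+ l B.· b′ , (begin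
    a ⊗ b +ᵗ a′ ⊗ b′                    ≈⟨ +ᵗ-cong (⊗-cong p B.≈-refl) (⊗-cong q B.≈-refl) ⟩
    (k A.· c) ⊗ b +ᵗ (l A.· c) ⊗ b′     ≈⟨ +ᵗ-cong (·-⊗ˡ k c b) (·-⊗ˡ l c b′) ⟩
    k · (c ⊗ b) +ᵗ l · (c ⊗ b′)         ≈⟨ +ᵗ-cong (·-⊗ʳ k c b) (·-⊗ʳ l c b′) ⟨
    c ⊗ (k B.· b) +ᵗ c ⊗ (l B.· b′)     ≈⟨ ⊗-distribˡ c _ _ ⟨
    c ⊗ (k B.· b B.+ l B.· b′)          ∎)
    where open Additive (A ⊗ᴳ B) using (_·_)

  pure : ∀ x → ∃ λ a → ∃ λ b → x ≈ᵗ a ⊗ b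
  pure (a ⊗ b) = a , b , reflᵗ
  pure 0ᵗ = A.0# , B.0# , symᵗ (0⊗ B.0#)
  pure (x +ᵗ y) = combine (pure x) (pure y)
    where
    combine : (∃ λ a → ∃ λ b → x ≈ᵗ a ⊗ b) → (∃ λ a → ∃ λ b → y ≈ᵗ a ⊗ b) →
              ∃ λ a → ∃ λ b → x +ᵗ y ≈ᵗ a ⊗ b
    combine (a , b , p) (a′ , b′ , q) =
      let c , d , r = pure-+ b b′ (L.common-generator a a′)
      in c , d , transᵗ (+ᵗ-cong p q) r
  pure (-ᵗ x) = negate (pure x)
    where
    negate : (∃ λ a → ∃ λ b → x ≈ᵗ a ⊗ b) → ∃ λ a → ∃ λ b → -ᵗ x ≈ᵗ a ⊗ b
    negate (a , b , p) = A.- a , b , transᵗ (-ᵗ-cong p) (symᵗ (-⊗ a b))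

  private
    product : Bilinear {A} {B} {ℚᴳ}
    product = record
      { β = λ a b → EA.φ a ℚᵘ.* EB.φ b
      ; βˡ = λ b → ∘-additive {A} {ℚᴳ} {ℚᴳ} (*-additiveˡ (EB.φ b)) EA.additive
      ; βʳ = λ a → ∘-additive {B} {ℚᴳ} {ℚᴳ} (*-additiveʳ (EA.φ a)) EB.additive
      }

  ⊗-embedding : NonzeroEmbedding (A ⊗ᴳ B)
  ⊗-embedding = record
    { φ = liftBilinear product
    ; additive = liftBilinear-additive product
    ; φ≃0⇒≈0 = injective
    ; a₀ = EA.a₀ ⊗ EB.a₀
    ; φa₀≄0 = nonzero
    }
    where
    nonzero : EA.φ EA.a₀ ℚᵘ.* EB.φ EB.a₀ ≃ 0ℚᵘ → ⊥
    nonzero e = [ EA.φa₀≄0 , EB.φa₀≄0 ]′ (ℚᵘ-zero-product (EA.φ EA.a₀) (EB.φ EB.a₀) e)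

    pure-injective : ∀ a b → EA.φ a ℚᵘ.* EB.φ b ≃ 0ℚᵘ → a ⊗ b ≈ᵗ 0ᵗ
    pure-injective a b e =
      [ (λ q → transᵗ (⊗-cong (EA.φ≃0⇒≈0 a q) B.≈-refl) (0⊗ b))
      , (λ q → transᵗ (⊗-cong A.≈-refl (EB.φ≃0⇒≈0 b q)) (⊗0 a))
      ]′ (ℚᵘ-zero-product (EA.φ a) (EB.φ b) e)

    injective : ∀ x → liftBilinear product x ≃ 0ℚᵘ → x ≈ᵗ 0ᵗ
    injective x e =
      let a , b , p = pure x
      in transᵗ p (pure-injective a b
           (ℚᵘ.≃-trans (ℚᵘ.≃-sym (IsAdditive.f-cong (liftBilinear-additive product) p)) e))

infixl 7 _⊗ᴾ_

_⊗ᴾ_ : RankOneGroup → RankOneGroup → RankOneGroup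
L ⊗ᴾ M = fromEmbedding (⊗-embedding L M)

1/1≄0 : ℤ→ℚᵘ 1ℤ ≃ 0ℚᵘ → ⊥
1/1≄0 (*≡* ())

ℤᴾ : RankOneGroup
ℤᴾ = fromEmbedding {ℤᴳ} record
  { φ = ℤ→ℚᵘ
  ; additive = ℤ→ℚᵘ-additive
  ; φ≃0⇒≈0 = λ k → ≃0⇒↥≡0 (ℤ→ℚᵘ k)
  ; a₀ = 1ℤ
  ; φa₀≄0 = 1/1≄0
  }

-- Isomorphism classes are represented by the groups themselves, with
-- isomorphism as the setoid equality.
Pic[Spec-ℤ] : CommutativeMonoid (lsuc 0ℓ) 0ℓ
Pic[Spec-ℤ] = record
  { Carrier = RankOneGroup
  ; _≈_ = λ L M → abelianGroup L ≅ abelianGroup M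
  ; _∙_ = _⊗ᴾ_
  ; ε = ℤᴾ
  ; isCommutativeMonoid = record
    { isMonoid = record
      { isSemigroup = record
        { isMagma = record
          { isEquivalence = record
            { refl = λ {L} → ≅-refl {abelianGroup L}
            ; sym = λ {L} {M} → ≅-sym {abelianGroup L} {abelianGroup M}
            ; trans = λ {L} {M} {N} →
                ≅-trans {abelianGroup L} {abelianGroup M} {abelianGroup N}
            }
          ; ∙-cong = λ {L} {L′} {M} {M′} →
              ⊗ᴳ-cong {abelianGroup L} {abelianGroup L′} {abelianGroup M} {abelianGroup M′}
          }
        ; assoc = λ L M N → ⊗ᴳ-assoc (abelianGroup L) (abelianGroup M) (abelianGroup N)
        }
      ; identity = (λ L → ⊗ᴳ-identityˡ (abelianGroup L)) , λ L →
          ≅-trans {abelianGroup L ⊗ᴳ ℤᴳ} {ℤᴳ ⊗ᴳ abelianGroup L} {abelianGroup L}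
            (⊗ᴳ-comm (abelianGroup L) ℤᴳ) (⊗ᴳ-identityˡ (abelianGroup L))
      }
    ; comm = λ L M → ⊗ᴳ-comm (abelianGroup L) (abelianGroup M)
    }
  }

-- A predicate on ℕ contained in Prime, rather than a predicate on
-- Σ ℕ Prime: the latter could depend on the proof of primality.
PrimeSubset : Set₁
PrimeSubset = Σ (Pred ℕ 0ℓ) (_⊆ Prime)

-- The subring of ℚ generated by the 1/p with p ∈ S.
data ℤ[1/_] (S : Pred ℕ 0ℓ) : Pred ℚ 0ℓ where
  one : 1ℚ ∈ ℤ[1/ S ]
  inv : ∀ {p} .{{_ : ℕ.NonZero p}} → p ∈ S → (1ℤ ℚ./ p) ∈ ℤ[1/ S ]
  add : ∀ {x y} → x ∈ ℤ[1/ S ] → y ∈ ℤ[1/ S ] → (x ℚ.+ y) ∈ ℤ[1/ S ]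
  neg : ∀ {x} → x ∈ ℤ[1/ S ] → (ℚ.- x) ∈ ℤ[1/ S ]
  mul : ∀ {x y} → x ∈ ℤ[1/ S ] → y ∈ ℤ[1/ S ] → (x ℚ.* y) ∈ ℤ[1/ S ]

localization-rawGroup : Pred ℕ 0ℓ → RawGroup 0ℓ 0ℓ
localization-rawGroup S = record
  { Carrier = ∃ ℤ[1/ S ]
  ; _≈_ = λ x y → proj₁ x ≡ proj₁ y
  ; _∙_ = λ (x , x∈) (y , y∈) → x ℚ.+ y , add x∈ y∈
  ; ε = 0ℚ , add one (neg one)
  ; _⁻¹ = λ (x , x∈) → ℚ.- x , neg x∈
  }

localization-abelianGroup : Pred ℕ 0ℓ → AbelianGroup 0ℓ 0ℓ
localization-abelianGroup S = record
  { RawGroup (localization-rawGroup S)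
  ; isAbelianGroup =
      GroupMonomorphism.isAbelianGroup inclusion-isMonomorphism ℚ.+-0-isAbelianGroup
  }
  where
  inclusion-isMonomorphism :
    IsGroupMonomorphism (localization-rawGroup S) ℚ.+-0-rawGroup proj₁
  inclusion-isMonomorphism = record
    { isGroupHomomorphism = record
      { isMonoidHomomorphism = record
        { isMagmaHomomorphism = record
          { isRelHomomorphism = record { cong = λ e → e }
          ; homo = λ _ _ → refl
          }
        ; ε-homo = refl
        }
      ; ⁻¹-homo = λ _ → refl
      }
    ; injective = λ e → e
    }

localization : Pred ℕ 0ℓ → RankOneGroup
localization S = fromEmbedding {localization-abelianGroup S} record
  { φ = λ x → toℚᵘ (proj₁ x)
  ; additive = record
    { f-cong = ℚ.toℚᵘ-cong
    ; f-+ = λ x y → ℚ.toℚᵘ-homo-+ (proj₁ x) (proj₁ y)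
    }
  ; φ≃0⇒≈0 = λ x → ℚ.toℚᵘ-injective
  ; a₀ = 1ℚ , one
  ; φa₀≄0 = 1/1≄0
  }

Θ : PrimeSubset → CommutativeMonoid.Carrier Pic[Spec-ℤ]
Θ (S , _) = localization S

{-# OPTIONS --safe #-}

-- An isomorphism A ⊗ A ≅ A makes A a ring without unit, and since A has rank 1
-- it embeds multiplicatively in ℚ as a subgroup B with B = B · B.  Such a B
-- contains 1: write a positive integer m ∈ B as y z with y, z ∈ B.  The
-- numerators r, r′ of y, z lie in B, hence so do gcd(m, r) and gcd(m, r′).
-- If neither is smaller than m, then m divides r and r′, so m is coprime to the
-- denominators s, s′, and m s s′ = r r′ forces m = 1.  So B is a subring of ℚ,
-- that is, B = ℤ[1/p | 1/p ∈ B].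
module Submission where

open import Algebra.Bundles using (CommutativeMonoid)
open import Algebra.Definitions using (_IdempotentOn_)
import Algebra.Properties.CommutativeSemigroup as CommutativeSemigroupProperties
import Algebra.Properties.Group as GroupProperties
open import Data.Empty using (⊥; ⊥-elim)
open import Data.Integer.Base as ℤ using (ℤ; +_; -[1+_]; 1ℤ)
import Data.Integer.Properties as ℤ
open import Data.List.Base using ([]; _∷_)
open import Data.List.Relation.Unary.All using (All; []; _∷_)
open import Data.Nat.Base as ℕ using (ℕ; zero; suc; NonZero)
open import Data.Nat.Coprimality as Coprimality using (Coprime; coprime-divisor)
open import Data.Nat.Divisibility as ℕ using (_∣_; divides; ∣-trans; ∣⇒≤)
open import Data.Nat.GCD using (gcd; gcd[m,n]∣m; gcd[m,n]∣n; gcd[m,n]≢0)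
open import Data.Nat.Induction using (<-rec)
open import Data.Nat.ListAction using (product)
open import Data.Nat.Primality using (Prime; prime⇒nonZero)
open import Data.Nat.Primality.Factorisation using (PrimeFactorisation; factorise)
import Data.Nat.Properties as ℕ
import Data.Nat.Solver as ℕ
open import Data.Product.Base using (∃; ∃₂; _×_; _,_; proj₁; proj₂)
open import Data.Rational.Base as ℚ using (ℚ; mkℚ; 0ℚ; 1ℚ; toℚᵘ; fromℚᵘ; ↥_; ↧_; ↧ₙ_)
import Data.Rational.Properties as ℚ
open import Data.Rational.Solver using (module +-*-Solver)
open import Data.Rational.Unnormalised.Base as ℚᵘ using (ℚᵘ; mkℚᵘ; 0ℚᵘ; 1ℚᵘ; _≃_; *≡*)
import Data.Rational.Unnormalised.Properties as ℚᵘ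
open import Data.Sum.Base using (_⊎_; inj₁; inj₂; [_,_]′)
open import Function.Base using (_∘_)
open import Function.Bundles using (_⇔_; mk⇔)
open import Level using (0ℓ)
open import Relation.Binary.Definitions using (tri<; tri≈; tri>)
open import Relation.Binary.PropositionalEquality
  using (_≡_; _≢_; refl; sym; trans; cong; cong₂; subst; module ≡-Reasoning)
import Relation.Binary.Reasoning.Setoid as SetoidReasoning
open import Relation.Unary using (Pred; _∈_; _⊆_)
open import Defs

-- Localizations of ℤ are idempotent under the tensor product.

kernel-surjective⇒≅ : ∀ {A B f} → IsAdditive A B f →
  (let module A = Additive A; module B = Additive B) →
  (∀ x → f x B.≈ B.0# → x A.≈ A.0#) → (∀ y → ∃ λ x → f x B.≈ y) → A ≅ B
kernel-surjective⇒≅ {A} {B} {f} F kernel surjective = f , record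
  { isGroupMonomorphism = record
    { isGroupHomomorphism = additive⇒isGroupHomomorphism {A} {B} f-cong f-+
    ; injective = λ {x} {y} e → GA.x∙y⁻¹≈ε⇒x≈y x y (kernel _
        (B.≈-trans (f-+ x (A.- y)) (B.≈-trans (B.+-congˡ (f-neg y)) (GB.x≈y⇒x∙y⁻¹≈ε e))))
    }
  ; surjective = λ y → proj₁ (surjective y) , λ e →
      B.≈-trans (f-cong e) (proj₂ (surjective y))
  }
  where
  module A = Additive A
  module B = Additive B
  module GA = GroupProperties A.group
  module GB = GroupProperties B.group
  open IsAdditive F

open CommutativeSemigroupProperties
  (CommutativeMonoid.commutativeSemigroup ℚ.*-1-commutativeMonoid)
  using (interchange; x∙yz≈yx∙z; xy∙z≈y∙xz)

ℚ-zero-product : ∀ x y → x ℚ.* y ≡ 0ℚ → x ≡ 0ℚ ⊎ y ≡ 0ℚ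
ℚ-zero-product x y e =
  [ inj₁ ∘ ℚ.toℚᵘ-injective , inj₂ ∘ ℚ.toℚᵘ-injective ]′
    (ℚᵘ-zero-product (toℚᵘ x) (toℚᵘ y)
      (ℚᵘ.≃-trans (ℚᵘ.≃-sym (ℚ.toℚᵘ-homo-* x y)) (ℚ.toℚᵘ-cong e)))

-- The isomorphism is multiplication. It is onto because `y` is the image of `y ⊗ 1`. Its kernel is
-- trivial because every tensor of rank-1 groups is pure, and a product vanishing in ℚ has a
-- vanishing factor.
localization-idempotent : ∀ S →
  localization-abelianGroup S ⊗ᴳ localization-abelianGroup S ≅ localization-abelianGroup S
localization-idempotent S = kernel-surjective⇒≅ {L ⊗ᴳ L} {L}
  (liftBilinear-additive multiply) kernel (λ y → y ⊗ (1ℚ , one) , ℚ.*-identityʳ (proj₁ y))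
  where
  L = localization-abelianGroup S
  module L = Additive L
  open TensorProduct L L

  multiply : Bilinear {L} {L} {L}
  multiply = record
    { β = λ (x , x∈) (y , y∈) → x ℚ.* y , mul x∈ y∈
    ; βˡ = λ (y , _) → record
        { f-cong = cong (ℚ._* y) ; f-+ = λ (x , _) (x′ , _) → ℚ.*-distribʳ-+ y x x′ }
    ; βʳ = λ (x , _) → record
        { f-cong = cong (x ℚ.*_) ; f-+ = λ (y , _) (y′ , _) → ℚ.*-distribˡ-+ x y y′ }
    }

  kernel : ∀ t → liftBilinear multiply t L.≈ L.0# → t ≈ᵗ 0ᵗ
  kernel t e with pure (localization S) (localization S) t
  ... | a , b , t≈a⊗b
    with ℚ-zero-product (proj₁ a) (proj₁ b)
           (trans (sym (liftBilinear-cong multiply t≈a⊗b)) e)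
  ... | inj₁ a≡0 = transᵗ t≈a⊗b (transᵗ (⊗-cong a≡0 refl) (0⊗ b))
  ... | inj₂ b≡0 = transᵗ t≈a⊗b (transᵗ (⊗-cong refl b≡0) (⊗0 a))

-- Integers, numerators and denominators inside ℚ.

fromℚᵘ-homo-+ : ∀ p q → fromℚᵘ (p ℚᵘ.+ q) ≡ fromℚᵘ p ℚ.+ fromℚᵘ q
fromℚᵘ-homo-+ p q = ℚ.toℚᵘ-injective (begin
  toℚᵘ (fromℚᵘ (p ℚᵘ.+ q))                  ≈⟨ ℚ.toℚᵘ-fromℚᵘ (p ℚᵘ.+ q) ⟩
  p ℚᵘ.+ q                                  ≈⟨ ℚᵘ.+-cong (ℚ.toℚᵘ-fromℚᵘ p) (ℚ.toℚᵘ-fromℚᵘ q) ⟨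
  toℚᵘ (fromℚᵘ p) ℚᵘ.+ toℚᵘ (fromℚᵘ q)      ≈⟨ ℚ.toℚᵘ-homo-+ (fromℚᵘ p) (fromℚᵘ q) ⟨
  toℚᵘ (fromℚᵘ p ℚ.+ fromℚᵘ q)              ∎)
  where open SetoidReasoning ℚᵘ.≃-setoid

fromℚᵘ-homo-* : ∀ p q → fromℚᵘ (p ℚᵘ.* q) ≡ fromℚᵘ p ℚ.* fromℚᵘ q
fromℚᵘ-homo-* p q = ℚ.toℚᵘ-injective (begin
  toℚᵘ (fromℚᵘ (p ℚᵘ.* q))                  ≈⟨ ℚ.toℚᵘ-fromℚᵘ (p ℚᵘ.* q) ⟩
  p ℚᵘ.* q                                  ≈⟨ ℚᵘ.*-cong (ℚ.toℚᵘ-fromℚᵘ p) (ℚ.toℚᵘ-fromℚᵘ q) ⟨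
  toℚᵘ (fromℚᵘ p) ℚᵘ.* toℚᵘ (fromℚᵘ q)      ≈⟨ ℚ.toℚᵘ-homo-* (fromℚᵘ p) (fromℚᵘ q) ⟨
  toℚᵘ (fromℚᵘ p ℚ.* fromℚᵘ q)              ∎)
  where open SetoidReasoning ℚᵘ.≃-setoid

ι : ℤ → ℚ
ι k = k ℚ./ 1

ι-+ : ∀ k l → ι (k ℤ.+ l) ≡ ι k ℚ.+ ι l
ι-+ k l = trans (ℚ.fromℚᵘ-cong (IsAdditive.f-+ ℤ→ℚᵘ-additive k l))
  (fromℚᵘ-homo-+ (ℤ→ℚᵘ k) (ℤ→ℚᵘ l))

ι-* : ∀ k l → ι (k ℤ.* l) ≡ ι k ℚ.* ι l
ι-* k l = fromℚᵘ-homo-* (ℤ→ℚᵘ k) (ℤ→ℚᵘ l)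

ι-injective : ∀ {k l} → ι k ≡ ι l → k ≡ l
ι-injective {k} {l} e with ℚ.fromℚᵘ-injective {ℤ→ℚᵘ k} {ℤ→ℚᵘ l} e
... | *≡* e′ = trans (sym (ℤ.*-identityʳ k)) (trans e′ (ℤ.*-identityʳ l))

ι↧*p≡ι↥ : ∀ p → ι (↧ p) ℚ.* p ≡ ι (↥ p)
ι↧*p≡ι↥ p@record{} = begin
  ι (↧ p) ℚ.* p                       ≡⟨ cong (ι (↧ p) ℚ.*_) (ℚ.fromℚᵘ-toℚᵘ p) ⟨
  ι (↧ p) ℚ.* fromℚᵘ (toℚᵘ p)         ≡⟨ fromℚᵘ-homo-* (ℤ→ℚᵘ (↧ p)) (toℚᵘ p) ⟨
  fromℚᵘ (ℤ→ℚᵘ (↧ p) ℚᵘ.* toℚᵘ p)     ≡⟨ ℚ.fromℚᵘ-cong {ℤ→ℚᵘ (↧ p) ℚᵘ.* toℚᵘ p} {ℤ→ℚᵘ (↥ p)} (*≡* (begin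
    (↧ p ℤ.* ↥ p) ℤ.* 1ℤ                ≡⟨ ℤ.*-identityʳ _ ⟩
    ↧ p ℤ.* ↥ p                         ≡⟨ ℤ.*-comm (↧ p) (↥ p) ⟩
    ↥ p ℤ.* ↧ p                         ≡⟨ cong (λ d → ↥ p ℤ.* + d) (ℕ.*-identityˡ (↧ₙ p)) ⟨
    ↥ p ℤ.* + (1 ℕ.* ↧ₙ p)              ∎)) ⟩
  ι (↥ p)                             ∎
  where open ≡-Reasoning

ι*1/n≡1 : ∀ n .{{_ : NonZero n}} → ι (+ n) ℚ.* (1ℤ ℚ./ n) ≡ 1ℚ
ι*1/n≡1 n@(suc d) = trans (sym (fromℚᵘ-homo-* (ℤ→ℚᵘ (+ n)) (mkℚᵘ 1ℤ d)))
  (ℚ.fromℚᵘ-cong {ℤ→ℚᵘ (+ n) ℚᵘ.* mkℚᵘ 1ℤ d} {1ℚᵘ} (*≡* (begin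
    (+ n ℤ.* 1ℤ) ℤ.* 1ℤ        ≡⟨ trans (ℤ.*-identityʳ _) (ℤ.*-identityʳ _) ⟩
    + n                        ≡⟨ cong +_ (ℕ.*-identityˡ n) ⟨
    + (1 ℕ.* n)                ≡⟨ ℤ.*-identityˡ _ ⟨
    1ℤ ℤ.* + (1 ℕ.* n)         ∎)))
  where open ≡-Reasoning

*≡1⇒≡1/n : ∀ n .{{_ : NonZero n}} {x} → ι (+ n) ℚ.* x ≡ 1ℚ → x ≡ 1ℤ ℚ./ n
*≡1⇒≡1/n n {x} e = begin
  x                       ≡⟨ ℚ.*-identityʳ x ⟨
  x ℚ.* 1ℚ                ≡⟨ cong (x ℚ.*_) (ι*1/n≡1 n) ⟨
  x ℚ.* (ι (+ n) ℚ.* y)   ≡⟨ x∙yz≈yx∙z x (ι (+ n)) y ⟩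
  (ι (+ n) ℚ.* x) ℚ.* y   ≡⟨ cong (ℚ._* y) e ⟩
  1ℚ ℚ.* y                ≡⟨ ℚ.*-identityˡ y ⟩
  y                       ∎
  where
  open ≡-Reasoning
  y = 1ℤ ℚ./ n

-- Integer multiples in additive subgroups of ℚ, applied below to both `B` and `ℤ[1/ S ]`.

module _ {P : Pred ℚ 0ℓ}
  (P-+ : ∀ {x y} → x ∈ P → y ∈ P → x ℚ.+ y ∈ P) (P-neg : ∀ {x} → x ∈ P → ℚ.- x ∈ P)
  where

  subgroup-multiple : ∀ n {x} → x ∈ P → ι (+ n) ℚ.* x ∈ P
  -- Membership of 0 is not among the closure assumptions; it is obtained as `x - x`.
  subgroup-multiple zero    {x} x∈P = subst P
    (trans (ℚ.+-inverseʳ x) (sym (ℚ.*-zeroˡ x))) (P-+ x∈P (P-neg x∈P))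
  subgroup-multiple (suc n) {x} x∈P = subst P (begin
    x ℚ.+ ι (+ n) ℚ.* x             ≡⟨ cong (ℚ._+ ι (+ n) ℚ.* x) (ℚ.*-identityˡ x) ⟨
    1ℚ ℚ.* x ℚ.+ ι (+ n) ℚ.* x      ≡⟨ ℚ.*-distribʳ-+ x 1ℚ (ι (+ n)) ⟨
    (1ℚ ℚ.+ ι (+ n)) ℚ.* x          ≡⟨ cong (ℚ._* x) (ι-+ 1ℤ (+ n)) ⟨
    ι (+ suc n) ℚ.* x               ∎)
    (P-+ x∈P (subgroup-multiple n x∈P))
    where open ≡-Reasoning

  subgroup-scale : ∀ k {x} → x ∈ P → ι k ℚ.* x ∈ P
  subgroup-scale (+ n)        x∈P = subgroup-multiple n x∈P
  subgroup-scale -[1+ n ] {x} x∈P = subst P (ℚ.neg-distribˡ-* (ι (+ suc n)) x)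
    (P-neg (subgroup-multiple (suc n) x∈P))

-- The coprimality proof stored in a rational is irrelevant; as coprimality is decidable, a usable
-- proof can be recomputed.
coprime-↥↧ : ∀ p → Coprime ℤ.∣ ↥ p ∣ (↧ₙ p)
coprime-↥↧ (mkℚ _ _ coprime) = Coprimality.recompute coprime

coprime-∣ˡ : ∀ {d m n} → d ∣ m → Coprime m n → Coprime d n
coprime-∣ˡ d∣m coprime (e∣d , e∣n) = coprime (∣-trans e∣d d∣m , e∣n)

-- With `r = u m` and `r′ = v m`, cancelling one `m` leaves `s s′ = u v m`. As a divisor of `r`, `m`
-- is coprime to `s`, hence divides `s′`; as a divisor of `r′` it is also coprime to `s′`, so it is
-- 1.
balanced⇒≡1 : ∀ {m r s r′ s′} .{{_ : NonZero m}} → m ∣ r → m ∣ r′ →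
  Coprime r s → Coprime r′ s′ → m ℕ.* (s ℕ.* s′) ≡ r ℕ.* r′ → m ≡ 1
balanced⇒≡1 {m} {r} {s} {r′} {s′} m∣r@(divides u refl) m∣r′@(divides v refl) rs r′s′ e =
  coprime-∣ˡ m∣r′ r′s′ (ℕ.∣-refl , coprime-divisor (coprime-∣ˡ m∣r rs)
    (divides (u ℕ.* v) (ℕ.*-cancelˡ-≡ _ _ m (trans e (ring m u v)))))
  where
  open ℕ.+-*-Solver
  ring : ∀ m u v → (u ℕ.* m) ℕ.* (v ℕ.* m) ≡ m ℕ.* ((u ℕ.* v) ℕ.* m)
  ring = solve 3 (λ m u v → (u :* m) :* (v :* m) := m :* ((u :* v) :* m)) refl

-- Multiplicatively idempotent subgroups of ℚ contain 1.

module IdempotentSubgroup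
  (B : Pred ℚ 0ℓ)
  (B-+ : ∀ {x y} → x ∈ B → y ∈ B → x ℚ.+ y ∈ B)
  (B-neg : ∀ {x} → x ∈ B → ℚ.- x ∈ B)
  (B-* : ∀ {x y} → x ∈ B → y ∈ B → x ℚ.* y ∈ B)
  -- A single product, not a sum of products, can be demanded: tensors of rank-1 groups are pure.
  (B-factor : ∀ {x} → x ∈ B → ∃₂ λ y z → y ∈ B × z ∈ B × x ≡ y ℚ.* z)
  {b₀ : ℚ} (b₀∈B : b₀ ∈ B) (b₀≢0 : b₀ ≢ 0ℚ)
  where

  B-scale : ∀ k {x} → x ∈ B → ι k ℚ.* x ∈ B
  B-scale = subgroup-scale B-+ B-neg

  B-↥ : ∀ {x} → x ∈ B → ι (↥ x) ∈ B
  B-↥ {x} x∈B = subst B (ι↧*p≡ι↥ x) (B-scale (↧ x) x∈B)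

  B-abs : ∀ k → ι k ∈ B → ι (+ ℤ.∣ k ∣) ∈ B
  B-abs k k∈B with abs-unit k
  ... | s , e = subst B (trans (sym (ι-* s k)) (cong ι (sym e))) (B-scale s k∈B)

  B-∣↥∣ : ∀ {x} → x ∈ B → ι (+ ℤ.∣ ↥ x ∣) ∈ B
  B-∣↥∣ {x} x∈B = B-abs (↥ x) (B-↥ x∈B)

  B-gcd : ∀ m n → ι (+ m) ∈ B → ι (+ n) ∈ B → ι (+ gcd m n) ∈ B
  B-gcd m n m∈B n∈B with bezout-ℕ m n
  ... | u , v , e = subst B
    (begin
      ι u ℚ.* ι (+ m) ℚ.+ ι v ℚ.* ι (+ n)  ≡⟨ cong₂ ℚ._+_ (ι-* u (+ m)) (ι-* v (+ n)) ⟨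
      ι (u ℤ.* + m) ℚ.+ ι (v ℤ.* + n)      ≡⟨ ι-+ (u ℤ.* + m) (v ℤ.* + n) ⟨
      ι (u ℤ.* + m ℤ.+ v ℤ.* + n)          ≡⟨ cong ι e ⟨
      ι (+ gcd m n)                        ∎)
    (B-+ (B-scale u m∈B) (B-scale v n∈B))
    where open ≡-Reasoning

  -- Multiplying `m = y z` by both denominators gives an identity of integers; absolute values bring
  -- it into the form required by `balanced⇒≡1`.
  cleared : ∀ m y z → ι (+ m) ≡ y ℚ.* z →
    m ℕ.* (↧ₙ y ℕ.* ↧ₙ z) ≡ ℤ.∣ ↥ y ∣ ℕ.* ℤ.∣ ↥ z ∣
  cleared m y z e = begin
    m ℕ.* (↧ₙ y ℕ.* ↧ₙ z)                 ≡⟨ cong (m ℕ.*_) (ℤ.abs-* (↧ y) (↧ z)) ⟨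
    m ℕ.* ℤ.∣ ↧ y ℤ.* ↧ z ∣               ≡⟨ ℤ.abs-* (+ m) (↧ y ℤ.* ↧ z) ⟨
    ℤ.∣ + m ℤ.* (↧ y ℤ.* ↧ z) ∣           ≡⟨ cong ℤ.∣_∣ (ι-injective {+ m ℤ.* (↧ y ℤ.* ↧ z)} {↥ y ℤ.* ↥ z} integral) ⟩
    ℤ.∣ ↥ y ℤ.* ↥ z ∣                     ≡⟨ ℤ.abs-* (↥ y) (↥ z) ⟩
    ℤ.∣ ↥ y ∣ ℕ.* ℤ.∣ ↥ z ∣               ∎
    where
    open ≡-Reasoning
    integral : ι (+ m ℤ.* (↧ y ℤ.* ↧ z)) ≡ ι (↥ y ℤ.* ↥ z)
    integral = begin
      ι (+ m ℤ.* (↧ y ℤ.* ↧ z))                 ≡⟨ ι-* (+ m) (↧ y ℤ.* ↧ z) ⟩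
      ι (+ m) ℚ.* ι (↧ y ℤ.* ↧ z)               ≡⟨ cong₂ ℚ._*_ e (ι-* (↧ y) (↧ z)) ⟩
      (y ℚ.* z) ℚ.* (ι (↧ y) ℚ.* ι (↧ z))       ≡⟨ ℚ.*-comm (y ℚ.* z) _ ⟩
      (ι (↧ y) ℚ.* ι (↧ z)) ℚ.* (y ℚ.* z)       ≡⟨ interchange (ι (↧ y)) (ι (↧ z)) y z ⟩
      (ι (↧ y) ℚ.* y) ℚ.* (ι (↧ z) ℚ.* z)       ≡⟨ cong₂ ℚ._*_ (ι↧*p≡ι↥ y) (ι↧*p≡ι↥ z) ⟩
      ι (↥ y) ℚ.* ι (↥ z)                       ≡⟨ ι-* (↥ y) (↥ z) ⟨
      ι (↥ y ℤ.* ↥ z)                           ∎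

  module _ {m : ℕ} .{{_ : NonZero m}} (m∈B : ι (+ m) ∈ B) where

    -- By Bézout `gcd m n` lies in `B`. It is nonzero and at most `m`, so it is either the smaller
    -- element sought or equal to `m`.
    smaller-or-∣ : ∀ n → ι (+ n) ∈ B →
      (∃ λ g → g ℕ.< m × NonZero g × ι (+ g) ∈ B) ⊎ m ∣ n
    smaller-or-∣ n n∈B with ℕ.<-cmp (gcd m n) m
    ... | tri< g<m _ _ = inj₁ (gcd m n , g<m ,
      ℕ.≢-nonZero (gcd[m,n]≢0 m n (inj₁ (ℕ.≢-nonZero⁻¹ m))) , B-gcd m n m∈B n∈B)
    ... | tri≈ _ g≡m _ = inj₂ (subst (_∣ n) g≡m (gcd[m,n]∣n m n))
    ... | tri> _ _ m<g = ⊥-elim (ℕ.<⇒≱ m<g (∣⇒≤ (gcd[m,n]∣m m n)))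

    smaller-or-≡1 : (∃ λ g → g ℕ.< m × NonZero g × ι (+ g) ∈ B) ⊎ m ≡ 1
    smaller-or-≡1 with B-factor m∈B
    ... | y , z , y∈B , z∈B , m≡yz
      with smaller-or-∣ ℤ.∣ ↥ y ∣ (B-∣↥∣ y∈B) | smaller-or-∣ ℤ.∣ ↥ z ∣ (B-∣↥∣ z∈B)
    ... | inj₁ smaller | _            = inj₁ smaller
    ... | inj₂ _       | inj₁ smaller = inj₁ smaller
    ... | inj₂ m∣↥y    | inj₂ m∣↥z    = inj₂
      (balanced⇒≡1 m∣↥y m∣↥z (coprime-↥↧ y) (coprime-↥↧ z) (cleared m y z m≡yz))

  -- Well-founded induction on `m`. `NonZero m` is an explicit argument so that it belongs to the
  -- property proved by induction.
  descent : ∀ m → NonZero m → ι (+ m) ∈ B → 1ℚ ∈ B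
  descent = <-rec _ λ m rec m≢0 m∈B →
    [ (λ (g , g<m , g≢0 , g∈B) → rec g<m g≢0 g∈B)
    , (λ m≡1 → subst (λ n → ι (+ n) ∈ B) m≡1 m∈B)
    ]′ (smaller-or-≡1 {{m≢0}} m∈B)

  1∈B : 1ℚ ∈ B
  1∈B = descent ℤ.∣ ↥ b₀ ∣
    (ℕ.≢-nonZero (b₀≢0 ∘ ℚ.↥p≡0⇒p≡0 b₀ ∘ ℤ.∣i∣≡0⇒i≡0)) (B-∣↥∣ b₀∈B)

  -- The subring `B` is the localization at the primes it inverts.

  ι∈B : ∀ k → ι k ∈ B
  ι∈B k = subst B (ℚ.*-identityʳ (ι k)) (B-scale k 1∈B)

  -- These are the primes `p` with `1/p` in `B`. The equation `p x = 1` replaces the term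
  -- `1ℤ ℚ./ p`, which would require a `NonZero p` instance for every natural number `p`.
  invertedPrimes : PrimeSubset
  invertedPrimes = (λ p → Prime p × ∃ λ x → x ∈ B × ι (+ p) ℚ.* x ≡ 1ℚ) , proj₁

  private
    S = proj₁ invertedPrimes

  ℤ[1/S]⊆B : ℤ[1/ S ] ⊆ B
  ℤ[1/S]⊆B one         = 1∈B
  ℤ[1/S]⊆B (inv {p} (_ , x , x∈B , px≡1)) = subst B (*≡1⇒≡1/n p px≡1) x∈B
  ℤ[1/S]⊆B (add x∈ y∈) = B-+ (ℤ[1/S]⊆B x∈) (ℤ[1/S]⊆B y∈)
  ℤ[1/S]⊆B (neg x∈)    = B-neg (ℤ[1/S]⊆B x∈)
  ℤ[1/S]⊆B (mul x∈ y∈) = B-* (ℤ[1/S]⊆B x∈) (ℤ[1/S]⊆B y∈)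

  ℤ[1/S]-ι : ∀ k → ι k ∈ ℤ[1/ S ]
  ℤ[1/S]-ι k = subst ℤ[1/ S ] (ℚ.*-identityʳ (ι k)) (subgroup-scale {ℤ[1/ S ]} add neg k one)

  -- Induction on the prime factors. If `x = 1/(p n)`, then `n x = 1/p` lies in `B`, so `p ∈ S`; and
  -- `p x = 1/n` is covered by induction. Then `x` is the product of `1/p` and `p x`.
  inverse∈ℤ[1/S] : ∀ ps → All Prime ps → ∀ {x} → x ∈ B →
    ι (+ product ps) ℚ.* x ≡ 1ℚ → x ∈ ℤ[1/ S ]
  inverse∈ℤ[1/S] [] [] {x} x∈B e =
    subst ℤ[1/ S ] (trans (sym e) (ℚ.*-identityˡ x)) one
  inverse∈ℤ[1/S] (p ∷ ps) (p-prime ∷ ps-prime) {x} x∈B e =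
    subst ℤ[1/ S ] (sym x≡) (mul (inv p∈S) (inverse∈ℤ[1/S] ps ps-prime px∈B n[px]≡1))
    where
    open ≡-Reasoning
    instance
      p≢0 : NonZero p
      p≢0 = prime⇒nonZero p-prime
    P = ι (+ p)
    N = ι (+ product ps)

    px∈B : P ℚ.* x ∈ B
    px∈B = B-scale (+ p) x∈B

    PN : ι (+ product (p ∷ ps)) ≡ P ℚ.* N
    PN = trans (cong ι (ℤ.pos-* p (product ps))) (ι-* (+ p) (+ product ps))

    PNx≡1 : (P ℚ.* N) ℚ.* x ≡ 1ℚ
    PNx≡1 = trans (cong (ℚ._* x) (sym PN)) e

    n[px]≡1 : N ℚ.* (P ℚ.* x) ≡ 1ℚ
    n[px]≡1 = trans (sym (xy∙z≈y∙xz P N x)) PNx≡1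

    p[nx]≡1 : P ℚ.* (N ℚ.* x) ≡ 1ℚ
    p[nx]≡1 = trans (sym (ℚ.*-assoc P N x)) PNx≡1

    p∈S : p ∈ S
    p∈S = p-prime , N ℚ.* x , B-scale (+ product ps) x∈B , p[nx]≡1

    x≡ : x ≡ (1ℤ ℚ./ p) ℚ.* (P ℚ.* x)
    x≡ = begin
      x                               ≡⟨ ℚ.*-identityˡ x ⟨
      1ℚ ℚ.* x                        ≡⟨ cong (ℚ._* x) (ι*1/n≡1 p) ⟨
      (P ℚ.* (1ℤ ℚ./ p)) ℚ.* x        ≡⟨ xy∙z≈y∙xz P (1ℤ ℚ./ p) x ⟩
      (1ℤ ℚ./ p) ℚ.* (P ℚ.* x)        ∎

  -- For `x = r/d` in lowest terms, Bézout gives integers with `a r + v d = 1`. Dividing by `d`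
  -- shows `1/d = a x + v`, which lies in `B` because `B` contains the integers.
  1/↧∈B : ∀ {x} → x ∈ B → ∃ λ c → c ∈ B × ι (↧ x) ℚ.* c ≡ 1ℚ
  1/↧∈B {x} x∈B
    with bezout-ℕ ℤ.∣ ↥ x ∣ (↧ₙ x) | abs-unit (↥ x)
  ... | u , v , bezout | s , ∣r∣≡sr =
    -- The factor `s` is a sign: `bezout-ℕ` speaks of the absolute value of the numerator, which is
    -- `s` times the numerator.
    ι (u ℤ.* s) ℚ.* x ℚ.+ ι v , B-+ (B-scale (u ℤ.* s) x∈B) (ι∈B v) , (begin
      D ℚ.* (ι (u ℤ.* s) ℚ.* x ℚ.+ ι v)             ≡⟨ ring D (ι (u ℤ.* s)) x (ι v) ⟩
      ι (u ℤ.* s) ℚ.* (D ℚ.* x) ℚ.+ ι v ℚ.* D       ≡⟨ cong (λ t → ι (u ℤ.* s) ℚ.* t ℚ.+ ι v ℚ.* D) (ι↧*p≡ι↥ x) ⟩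
      ι (u ℤ.* s) ℚ.* ι (↥ x) ℚ.+ ι v ℚ.* D         ≡⟨ cong₂ ℚ._+_ (ι-* (u ℤ.* s) (↥ x)) (ι-* v (↧ x)) ⟨
      ι (u ℤ.* s ℤ.* ↥ x) ℚ.+ ι (v ℤ.* ↧ x)         ≡⟨ ι-+ (u ℤ.* s ℤ.* ↥ x) (v ℤ.* ↧ x) ⟨
      ι (u ℤ.* s ℤ.* ↥ x ℤ.+ v ℤ.* ↧ x)             ≡⟨ cong ι combination ⟩
      ι 1ℤ                                          ∎)
    where
    open ≡-Reasoning
    D = ι (↧ x)

    ring : ∀ d a x b → d ℚ.* (a ℚ.* x ℚ.+ b) ≡ a ℚ.* (d ℚ.* x) ℚ.+ b ℚ.* d
    ring = solve 4 (λ d a x b → d :* (a :* x :+ b) := a :* (d :* x) :+ b :* d) refl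
      where open +-*-Solver

    combination : u ℤ.* s ℤ.* ↥ x ℤ.+ v ℤ.* ↧ x ≡ 1ℤ
    combination = begin
      u ℤ.* s ℤ.* ↥ x ℤ.+ v ℤ.* ↧ x         ≡⟨ cong (ℤ._+ v ℤ.* ↧ x) (ℤ.*-assoc u s (↥ x)) ⟩
      u ℤ.* (s ℤ.* ↥ x) ℤ.+ v ℤ.* ↧ x       ≡⟨ cong (λ t → u ℤ.* t ℤ.+ v ℤ.* ↧ x) ∣r∣≡sr ⟨
      u ℤ.* + ℤ.∣ ↥ x ∣ ℤ.+ v ℤ.* ↧ x       ≡⟨ bezout ⟨
      + gcd ℤ.∣ ↥ x ∣ (↧ₙ x)                ≡⟨ cong +_ (Coprimality.coprime⇒gcd≡1 (coprime-↥↧ x)) ⟩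
      1ℤ                                    ∎

  1/n∈B⇒∈ℤ[1/S] : ∀ {n} → PrimeFactorisation n → ∀ {c} → c ∈ B →
    ι (+ n) ℚ.* c ≡ 1ℚ → c ∈ ℤ[1/ S ]
  1/n∈B⇒∈ℤ[1/S] record { factors = ps ; isFactorisation = refl ; factorsPrime = prime } =
    inverse∈ℤ[1/S] ps prime

  -- An element is its numerator times the inverse `c` of its denominator. That inverse lies in `B`,
  -- and factoring the denominator into primes places it in `ℤ[1/ S ]`.
  B⊆ℤ[1/S] : B ⊆ ℤ[1/ S ]
  B⊆ℤ[1/S] {x} x∈B =
    let c , c∈B , dc≡1 = 1/↧∈B x∈B in
    subst ℤ[1/ S ]
      (begin
        ι (↥ x) ℚ.* c                ≡⟨ cong (ℚ._* c) (ι↧*p≡ι↥ x) ⟨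
        (ι (↧ x) ℚ.* x) ℚ.* c        ≡⟨ xy∙z≈y∙xz (ι (↧ x)) x c ⟩
        x ℚ.* (ι (↧ x) ℚ.* c)        ≡⟨ cong (x ℚ.*_) dc≡1 ⟩
        x ℚ.* 1ℚ                     ≡⟨ ℚ.*-identityʳ x ⟩
        x                            ∎)
      (mul (ℤ[1/S]-ι (↥ x)) (1/n∈B⇒∈ℤ[1/S] (factorise (↧ₙ x)) c∈B dc≡1))
    where open ≡-Reasoning

-- Realizing an idempotent rank-1 group as a multiplicatively idempotent subgroup of ℚ.

module IdempotentGroup (L : RankOneGroup)
  (idempotent : RankOneGroup.abelianGroup L ⊗ᴳ RankOneGroup.abelianGroup L
                  ≅ RankOneGroup.abelianGroup L) where

  private
    A = RankOneGroup.abelianGroup L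
    module A = Additive A
  open TensorProduct A A using (_⊗_)
  open Rank1 A (RankOneGroup.torsionFree L) (RankOneGroup.rank1 L)
  open Inverses (≅⇒Inverses {A ⊗ᴳ A} {A} idempotent)

  fraction-additive : IsAdditive A ℚᴳ fraction
  fraction-additive = record { f-cong = fraction-cong ; f-+ = fraction-+ }

  fraction-generator : fraction generator ≃ 1ℚᵘ
  fraction-generator = fraction-ratio generator 1ℤ 0 A.≈-refl

  -- An additive map to ℚ is determined by its value at `generator`: a relation `D a = m generator`
  -- with `D` positive forces `D f(a) = m f(generator)`, and `D` is invertible in ℚ.
  additive-fraction : ∀ {f} → IsAdditive A ℚᴳ f → ∀ a → f a ≃ fraction a ℚᵘ.* f generator
  additive-fraction {f} F a with ratio a
  ... | m , d , e = scaled (f a) (f generator) (begin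
      ℤ→ℚᵘ (+ suc d) ℚᵘ.* f a        ≈⟨ ℚᵘ-· (+ suc d) (f a) ⟨
      (+ suc d) · f a                ≈⟨ f-· (+ suc d) a ⟨
      f ((+ suc d) A.· a)            ≈⟨ f-cong e ⟩
      f (m A.· generator)            ≈⟨ f-· m generator ⟩
      m · f generator                ≈⟨ ℚᵘ-· m (f generator) ⟩
      ℤ→ℚᵘ m ℚᵘ.* f generator        ∎)
    where
    open IsAdditive F
    open Additive ℚᴳ using (_·_)
    open SetoidReasoning ℚᵘ.≃-setoid
    1/D = mkℚᵘ 1ℤ d

    1/D*D : 1/D ℚᵘ.* ℤ→ℚᵘ (+ suc d) ≃ 1ℚᵘ
    1/D*D = ℚᵘ.*-inverseˡ (ℤ→ℚᵘ (+ suc d))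

    1/D*m : 1/D ℚᵘ.* ℤ→ℚᵘ m ≃ mkℚᵘ m d
    1/D*m = ℚᵘ.≃-reflexive (cong₂ mkℚᵘ (ℤ.*-identityˡ m) (ℕ.*-identityʳ d))

    scaled : ∀ p q → ℤ→ℚᵘ (+ suc d) ℚᵘ.* p ≃ ℤ→ℚᵘ m ℚᵘ.* q → p ≃ mkℚᵘ m d ℚᵘ.* q
    scaled p q h = begin
      p                                        ≈⟨ ℚᵘ.*-identityˡ p ⟨
      1ℚᵘ ℚᵘ.* p                               ≈⟨ ℚᵘ.*-congʳ {p} 1/D*D ⟨
      (1/D ℚᵘ.* ℤ→ℚᵘ (+ suc d)) ℚᵘ.* p         ≈⟨ ℚᵘ.*-assoc 1/D (ℤ→ℚᵘ (+ suc d)) p ⟩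
      1/D ℚᵘ.* (ℤ→ℚᵘ (+ suc d) ℚᵘ.* p)         ≈⟨ ℚᵘ.*-congˡ {1/D} h ⟩
      1/D ℚᵘ.* (ℤ→ℚᵘ m ℚᵘ.* q)                 ≈⟨ ℚᵘ.*-assoc 1/D (ℤ→ℚᵘ m) q ⟨
      (1/D ℚᵘ.* ℤ→ℚᵘ m) ℚᵘ.* q                 ≈⟨ ℚᵘ.*-congʳ {q} 1/D*m ⟩
      mkℚᵘ m d ℚᵘ.* q                          ∎

  infixl 7 _⋆_

  _⋆_ : A.Carrier → A.Carrier → A.Carrier
  a ⋆ b = to (a ⊗ b)

  to-additive : IsAdditive (A ⊗ᴳ A) A to
  to-additive = record { f-cong = to-cong ; f-+ = to-+ }

  scale : ℚᵘ
  scale = fraction (generator ⋆ generator)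

  -- The left side is additive in each variable, so `additive-fraction` applies first in `a`, then
  -- in `b`, leaving the value at the pair of generators.
  fraction-⋆ : ∀ a b → fraction (a ⋆ b) ≃ fraction a ℚᵘ.* (fraction b ℚᵘ.* scale)
  fraction-⋆ a b = ℚᵘ.≃-trans
    (additive-fraction (∘-additive {A} {A ⊗ᴳ A} {ℚᴳ} fraction∘to (⊗-additiveˡ b)) a)
    (ℚᵘ.*-congˡ {fraction a}
      (additive-fraction (∘-additive {A} {A ⊗ᴳ A} {ℚᴳ} fraction∘to (⊗-additiveʳ generator)) b))
    where
    fraction∘to : IsAdditive (A ⊗ᴳ A) ℚᴳ (λ t → fraction (to t))
    fraction∘to = ∘-additive {A ⊗ᴳ A} {A} {ℚᴳ} fraction-additive to-additive

  -- The preimage of `a` in the tensor square is a pure tensor.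
  factorisation : ∀ a → ∃₂ λ c d → a A.≈ c ⋆ d
  factorisation a with pure L L (from a)
  ... | c , d , e = c , d , A.≈-trans (A.≈-sym (to-from a)) (to-cong e)

  -- Rescaled so that ⋆, on which `fraction` is multiplicative only up to `scale`,
  -- becomes the multiplication of ℚ.
  ψ : A.Carrier → ℚ
  ψ a = fromℚᵘ (fraction a ℚᵘ.* scale)

  ψ-cong : ∀ {a b} → a A.≈ b → ψ a ≡ ψ b
  ψ-cong e = ℚ.fromℚᵘ-cong (ℚᵘ.*-congʳ (fraction-cong e))

  ψ-+ : ∀ a b → ψ (a A.+ b) ≡ ψ a ℚ.+ ψ b
  ψ-+ a b = trans
    (ℚ.fromℚᵘ-cong (ℚᵘ.≃-trans (ℚᵘ.*-congʳ (fraction-+ a b))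
      (ℚᵘ.*-distribʳ-+ scale (fraction a) (fraction b))))
    (fromℚᵘ-homo-+ (fraction a ℚᵘ.* scale) (fraction b ℚᵘ.* scale))

  ψ-neg : ∀ a → ψ (A.- a) ≡ ℚ.- ψ a
  ψ-neg = additive-neg {A} {ℚ.+-0-abelianGroup} ψ-cong ψ-+

  ψ-⋆ : ∀ a b → ψ (a ⋆ b) ≡ ψ a ℚ.* ψ b
  ψ-⋆ a b = trans
    (ℚ.fromℚᵘ-cong (ℚᵘ.≃-trans (ℚᵘ.*-congʳ (fraction-⋆ a b))
      (xy∙z≈xz∙y (fraction a) (fraction b ℚᵘ.* scale) scale)))
    (fromℚᵘ-homo-* (fraction a ℚᵘ.* scale) (fraction b ℚᵘ.* scale))
    where
    open CommutativeSemigroupProperties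
      (CommutativeMonoid.commutativeSemigroup ℚᵘ.*-1-commutativeMonoid) using (xy∙z≈xz∙y)

  -- If `scale` vanished, so would the fraction of every product `c ⋆ d`; but `generator` is such a
  -- product and has fraction 1.
  scale≄0 : scale ≃ 0ℚᵘ → ⊥
  scale≄0 scale≃0 with factorisation generator
  ... | c , d , e = 1/1≄0 (begin
    1ℚᵘ                                              ≈⟨ fraction-generator ⟨
    fraction generator                               ≈⟨ fraction-cong e ⟩
    fraction (c ⋆ d)                                 ≈⟨ fraction-⋆ c d ⟩
    fraction c ℚᵘ.* (fraction d ℚᵘ.* scale)          ≈⟨ ℚᵘ.*-congˡ {fraction c} (ℚᵘ.*-congˡ {fraction d} scale≃0) ⟩
    fraction c ℚᵘ.* (fraction d ℚᵘ.* 0ℚᵘ)            ≈⟨ ℚᵘ.*-congˡ {fraction c} (ℚᵘ.*-zeroʳ (fraction d)) ⟩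
    fraction c ℚᵘ.* 0ℚᵘ                              ≈⟨ ℚᵘ.*-zeroʳ (fraction c) ⟩
    0ℚᵘ                                              ∎)
    where open SetoidReasoning ℚᵘ.≃-setoid

  ψ-kernel : ∀ a → ψ a ≡ 0ℚ → a A.≈ A.0#
  ψ-kernel a e =
    [ fraction-0 a , ⊥-elim ∘ scale≄0 ]′
      (ℚᵘ-zero-product (fraction a) scale
        (ℚ.fromℚᵘ-injective {fraction a ℚᵘ.* scale} {0ℚᵘ} e))

  Image : Pred ℚ 0ℓ
  Image q = ∃ λ a → ψ a ≡ q

  Image-+ : ∀ {x y} → x ∈ Image → y ∈ Image → x ℚ.+ y ∈ Image
  Image-+ (a , refl) (b , refl) = a A.+ b , ψ-+ a b

  Image-neg : ∀ {x} → x ∈ Image → ℚ.- x ∈ Image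
  Image-neg (a , refl) = A.- a , ψ-neg a

  Image-* : ∀ {x y} → x ∈ Image → y ∈ Image → x ℚ.* y ∈ Image
  Image-* (a , refl) (b , refl) = a ⋆ b , ψ-⋆ a b

  Image-factor : ∀ {x} → x ∈ Image → ∃₂ λ y z → y ∈ Image × z ∈ Image × x ≡ y ℚ.* z
  Image-factor (a , refl) with factorisation a
  ... | c , d , e = ψ c , ψ d , (c , refl) , (d , refl) , trans (ψ-cong e) (ψ-⋆ c d)

  ψ-generator≢0 : ψ generator ≢ 0ℚ
  ψ-generator≢0 e = 1/1≄0 (ℚᵘ.≃-trans (ℚᵘ.≃-sym fraction-generator)
    (ℚᵘ.≃-trans (fraction-cong (ψ-kernel generator e)) (IsAdditive.f-0 fraction-additive)))

  open IdempotentSubgroup Image Image-+ Image-neg Image-* Image-factor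
    (generator , refl) ψ-generator≢0

  idempotent⇒localization : ∃ λ S → RankOneGroup.abelianGroup (Θ S) ≅ A
  idempotent⇒localization = invertedPrimes , ≅-sym {A} {localization-abelianGroup S}
    -- The map is `ψ` with its codomain restricted to `ℤ[1/ S ]`. Surjectivity is the reverse
    -- inclusion, since membership in `Image` is a preimage under `ψ`.
    (kernel-surjective⇒≅ {A} {localization-abelianGroup S} {λ a → ψ a , B⊆ℤ[1/S] (a , refl)}
      (record { f-cong = ψ-cong ; f-+ = ψ-+ })
      ψ-kernel (λ (_ , x∈) → ℤ[1/S]⊆B x∈))
    where S = proj₁ invertedPrimes

-- Idempotent classes compared with the image of `Θ`.

theorem2p16 : let open CommutativeMonoid Pic[Spec-ℤ] in
    ∀ (x : Carrier) → (∃ λ (S : PrimeSubset) → Θ S ≈ x) ⇔ _IdempotentOn_ _≈_ _∙_ x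
theorem2p16 x = mk⇔ image⇒idempotent (IdempotentGroup.idempotent⇒localization x)
  where
  open CommutativeMonoid Pic[Spec-ℤ] using (_≈_; _∙_)
  A = RankOneGroup.abelianGroup x

  image⇒idempotent : (∃ λ S → Θ S ≈ x) → _IdempotentOn_ _≈_ _∙_ x
  image⇒idempotent ((S , _) , L≅A) =
    -- Idempotence is carried from `L` to `A` along `A ⊗ A ≅ L ⊗ L ≅ L ≅ A`.
    ≅-trans {A ⊗ᴳ A} {L ⊗ᴳ L} {A}
      (⊗ᴳ-cong {A} {L} {A} {L} A≅L A≅L)
      (≅-trans {L ⊗ᴳ L} {L} {A} (localization-idempotent S) L≅A)
    where
    L = localization-abelianGroup S
    A≅L = ≅-sym {L} {A} L≅A
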